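{- Let $\mathbb{Z}_3^n$ denote the $n$-dimensional discrete torus of side length $3$ (the $n$-th Cartesian power of the triangle). Then the number $|\mathcal{I}(\mathbb{Z}_3^n)|$ of independent sets of $\mathbb{Z}_3^n$ satisfies \[ |\mathcal{I}(\mathbb{Z}_3^n)| \geq (1-o(1)) \cdot 3 \cdot 2^{n-1} \cdot 2^{3^{n-1}} \cdot \exp\big( (3/2)^{n-1} \big) \] as $n \to \infty$.
   Context: For $m,n\in\mathbb{N}$, the discrete torus $\mathbb{Z}_m^n$ is the graph with vertex set $\{0,1,\ldots,m-1\}^n$ in which $u,v$ are adjacent iff there is $j\in[n]$ with $u_j \equiv v_j \pm 1 \pmod m$ and $u_i=v_i$ for all $i\neq j$. An independent set is a vertex set spanning no edges (the empty set included). $o(1)$ denotes a quantity tending to $0$ as $n\to\infty$. -}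

module Defs where

open import Data.Nat using (ℕ; zero; suc; _+_; _*_; _∸_; _^_; _%_; NonZero)
open import Data.Nat.Properties using (_≟_)
open import Data.Fin using (Fin; toℕ)
open import Data.Fin.Properties using (any?; all?) renaming (_≟_ to _≟ᶠ_)
open import Data.Vec using (Vec; []; _∷_; lookup)
open import Data.List using (List; []; _∷_; [_]; _++_; map; concatMap; filter; length; allFin)
open import Data.List.Relation.Unary.All using (All)
import Data.List.Relation.Unary.All as All
open import Data.Integer using (+_)
open import Data.Rational using (ℚ; 1ℚ; _/_) renaming (_*_ to _*ℚ_; _+_ to _+ℚ_)
open import Data.Product using (Σ; _×_; _,_)
open import Data.Sum using (_⊎_)
open import Relation.Nullary using (¬_; Dec; yes; no)
open import Relation.Nullary.Decidable using (_×-dec_; _⊎-dec_; ¬?; _→-dec_)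
open import Relation.Binary.PropositionalEquality using (_≡_; _≢_)

Vertex : ℕ → ℕ → Set
Vertex m n = Vec (Fin m) n

Adjacent : (m n : ℕ) → .{{_ : NonZero m}} → Vertex m n → Vertex m n → Set
Adjacent m n u v =
  Σ (Fin n) λ j →
    (toℕ (lookup u j) ≡ (toℕ (lookup v j) + 1) % m
      ⊎ toℕ (lookup v j) ≡ (toℕ (lookup u j) + 1) % m)
    × (∀ i → i ≢ j → lookup u i ≡ lookup v i)

adjacent? : (m n : ℕ) → .{{_ : NonZero m}} → (u v : Vertex m n) → Dec (Adjacent m n u v)
adjacent? m n u v = any? λ j →
  ((toℕ (lookup u j) ≟ (toℕ (lookup v j) + 1) % m)
     ⊎-dec (toℕ (lookup v j) ≟ (toℕ (lookup u j) + 1) % m))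
  ×-dec all? (λ i → ¬? (i ≟ᶠ j) →-dec (lookup u i ≟ᶠ lookup v i))

vertices : (m n : ℕ) → List (Vertex m n)
vertices m zero = [ [] ]
vertices m (suc n) = concatMap (λ v → map (_∷ v) (allFin m)) (vertices m n)

-- All sublists of a list (= all subsets when the list has no duplicates).
sublists : ∀ {A : Set} → List A → List (List A)
sublists [] = [ [] ]
sublists (x ∷ xs) = sublists xs ++ map (x ∷_) (sublists xs)

Independent : (m n : ℕ) → .{{_ : NonZero m}} → List (Vertex m n) → Set
Independent m n S = All (λ u → All (λ v → ¬ Adjacent m n u v) S) S

independent? : (m n : ℕ) → .{{_ : NonZero m}} → (S : List (Vertex m n)) → Dec (Independent m n S)
independent? m n S = All.all? (λ u → All.all? (λ v → ¬? (adjacent? m n u v)) S) S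

numIndependentSets : (m n : ℕ) → .{{_ : NonZero m}} → ℕ
numIndependentSets m n = length (filter (independent? m n) (sublists (vertices m n)))

ℕtoℚ : ℕ → ℚ
ℕtoℚ k = + k / 1

powℚ : ℚ → ℕ → ℚ
powℚ q zero = 1ℚ
powℚ q (suc k) = q *ℚ powℚ q k

expTerm : ℚ → ℕ → ℚ
expTerm x zero = 1ℚ
expTerm x (suc k) = expTerm x k *ℚ x *ℚ (+ 1 / suc k)

-- Partial sum of the exponential series: Σ_{k=0}^{K} x^k / k!.
-- For x ≥ 0, exp x is the supremum of these partial sums.
expPartial : ℚ → ℕ → ℚ
expPartial x zero = expTerm x zero
expPartial x (suc K) = expPartial x K +ℚ expTerm x (suc K)

{-# OPTIONS --safe #-}

-- Fix one of the 3 · 2^(n−1) maximum independent sets M of the torus; it has 3^(n−1) elements, and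
-- every vertex has at most n neighbours in M.  An independent set D of "defects" outside M therefore
-- extends to at least 2^(|M| − n|D|) independent sets S with S ∖ M = D.  Summing 2^(−n|D|) over all
-- subsets D of the complement of M gives (1 + 2^(−n))^N with N = 2 · 3^(n−1), and N 2^(−n) = (3/2)^(n−1).
-- The subsets D that contain an edge or have more than t = 3^(n−5) elements contribute a negligible
-- part.  By Bonferroni it remains to see that few S have at most t defects for both of two distinct
-- M, M′: all but 2t elements of such an S lie in M ∩ M′, which has at most 3^(n−2) elements.
-- Finally E (1 − y)^N ≤ 1 for every partial sum E of the series of exp(N y), and
-- (1 + y)^N (1 − y)^N = (1 − y²)^N ≥ 1 − N y², so that (1 + y)^N ≥ (1 − N y²) E for y = 2^(−n).
module Submission where

open import Defs

-- The sets M come from affine forms: for signs s with s₁ = +1 and a constant c, M consists of the u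
-- with c + s₁u₁ + ... + sₙuₙ ≡ 0 modulo 3. A line in a coordinate direction meets M in exactly one
-- point, and this single fact yields the size of M, the degree bound and, by induction on the
-- dimension, the bound on M ∩ M′. The threshold t has to meet two opposite demands. The sets D with
-- more than t elements have total weight at most 2^N · 2^(-nt), so nt must exceed N. On the other
-- hand 2t stray elements must not outweigh the gap between M and M ∩ M′, so t must be a small
-- constant fraction of |M|. Both are possible because n grows while N / |M| stays 2. As (1 + y)^N
-- stays below exp(N y), it cannot be compared with the series directly; (1 - y)^(-N) lies above
-- exp(N y), and the factor (1 - y²)^N is the price of the exchange. The counting is done in ℕ with
-- every inequality multiplied by its denominators, so that an error o(1) appears as a term with
-- coefficient 1 beside terms with coefficient q or c.

module Counting where
  open import Data.Bool using (Bool; true; false; not; if_then_else_) renaming (_≟_ to _≟ᵇ_)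
  open import Data.Empty using (⊥-elim)
  open import Data.Fin using (Fin; zero; suc; toℕ)
  open import Data.Fin.Properties using (suc-injective) renaming (_≟_ to _≟ᶠ_; all? to allᶠ?)
  open import Data.List
    using (List; []; _∷_; _++_; map; length; filter; allFin; concatMap; cartesianProduct; cartesianProductWith)
  open import Data.List.Membership.Propositional using (_∈_)
  open import Data.List.Membership.Propositional.Properties using (∈-filter⁺)
  open import Data.List.Properties using (map-++; map-∘; map-cong; length-++; length-map)
  open import Data.List.Relation.Unary.All using (All; []; _∷_)
  import Data.List.Relation.Unary.All as All
  open import Data.List.Relation.Unary.AllPairs using (AllPairs; []; _∷_)
  import Data.List.Relation.Unary.AllPairs as AllPairs
  open import Data.List.Relation.Unary.Unique.Propositional using (Unique)
  open import Data.List.Relation.Unary.Unique.Propositional.Properties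
    using (cartesianProduct⁺; cartesianProductWith⁺; allFin⁺)
  open import Data.Nat using (ℕ; zero; suc; _+_; _∸_; _^_; _%_; _≤_; _<_; _≤?_; z≤n; s≤s; NonZero) renaming (_*_ to _*ℕ_)
  open import Data.Nat.ListAction using (sum)
  open import Data.Nat.ListAction.Properties using (sum-++)
  open import Data.Nat.Properties hiding (suc-injective)
  open import Data.Nat.Tactic.RingSolver using (solve-∀)
  open import Data.Product using (_×_; _,_; proj₁)
  open import Data.Sum using (_⊎_; inj₁; inj₂; swap)
  open import Data.Vec using (Vec; []; _∷_; lookup)
  open import Data.Vec.Properties using (∷-injective; ≡-dec)
  open import Data.Vec.Relation.Binary.Pointwise.Extensional using (ext; Pointwise-≡⇒≡)
  open import Function using (_∘_)
  open import Relation.Binary.PropositionalEquality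
  open import Relation.Nullary using (¬_; Dec; yes; no; does; ¬?)
  open import Relation.Nullary.Decidable using (from-yes; _×-dec_; _→-dec_)
  open import Relation.Unary using (Decidable)

  -- Sums over sublists

  ind : {P : Set} → Dec P → ℕ
  ind d = if does d then 1 else 0

  ind-mono : {P Q : Set} (p : Dec P) (q : Dec Q) → (P → Q) → ind p ≤ ind q
  ind-mono (no _)  q       f = z≤n
  ind-mono (yes p) (yes q) f = ≤-refl
  ind-mono (yes p) (no ¬q) f = ⊥-elim (¬q (f p))

  ind-elim : {P : Set} (p : Dec P) {k : ℕ} → (P → 1 ≤ k) → ind p ≤ k
  ind-elim (yes p) f = f p
  ind-elim (no _)  f = z≤n

  ind-*-elim : {P Q : Set} (p : Dec P) (q : Dec Q) {k : ℕ} → (P → Q → 1 ≤ k) → ind p *ℕ ind q ≤ k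
  ind-*-elim (yes p) (yes q) f = f p q
  ind-*-elim (yes p) (no _)  f = z≤n
  ind-*-elim (no _)  q       f = z≤n

  ind-true : {P : Set} (p : Dec P) → P → ind p ≡ 1
  ind-true (yes _) p = refl
  ind-true (no ¬p) p = ⊥-elim (¬p p)

  ind-false : {P : Set} (p : Dec P) → ¬ P → ind p ≡ 0
  ind-false (yes p) ¬p = ⊥-elim (¬p p)
  ind-false (no _)  ¬p = refl

  ind≤1 : {P : Set} (p : Dec P) → ind p ≤ 1
  ind≤1 (yes _) = ≤-refl
  ind≤1 (no _)  = z≤n

  private variable
    A C : Set

  ∑ : List A → (A → ℕ) → ℕ
  ∑ xs f = sum (map f xs)

  ∑-cong : (xs : List A) {f g : A → ℕ} → (∀ x → f x ≡ g x) → ∑ xs f ≡ ∑ xs g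
  ∑-cong xs p = cong sum (map-cong p xs)

  ∑-mono : (xs : List A) {f g : A → ℕ} → (∀ x → f x ≤ g x) → ∑ xs f ≤ ∑ xs g
  ∑-mono []       p = z≤n
  ∑-mono (x ∷ xs) p = +-mono-≤ (p x) (∑-mono xs p)

  ∑-++ : (xs ys : List A) (f : A → ℕ) → ∑ (xs ++ ys) f ≡ ∑ xs f + ∑ ys f
  ∑-++ xs ys f = trans (cong sum (map-++ f xs ys)) (sum-++ (map f xs) (map f ys))

  ∑-map : (g : A → C) (xs : List A) (f : C → ℕ) → ∑ (map g xs) f ≡ ∑ xs (f ∘ g)
  ∑-map g xs f = cong sum (sym (map-∘ xs))

  +-interchange : ∀ a b c d → (a + b) + (c + d) ≡ (a + c) + (b + d)
  +-interchange = solve-∀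

  ∑-+ : (xs : List A) (f g : A → ℕ) → ∑ xs (λ x → f x + g x) ≡ ∑ xs f + ∑ xs g
  ∑-+ []       f g = refl
  ∑-+ (x ∷ xs) f g = trans (cong (f x + g x +_) (∑-+ xs f g)) (+-interchange (f x) (g x) _ _)

  ∑-* : (xs : List A) (c : ℕ) (f : A → ℕ) → ∑ xs (λ x → c *ℕ f x) ≡ c *ℕ ∑ xs f
  ∑-* []       c f = sym (*-zeroʳ c)
  ∑-* (x ∷ xs) c f = trans (cong (c *ℕ f x +_) (∑-* xs c f)) (sym (*-distribˡ-+ c (f x) _))

  ∑-const : (xs : List A) (c : ℕ) → ∑ xs (λ _ → c) ≡ length xs *ℕ c
  ∑-const []       c = refl
  ∑-const (x ∷ xs) c = cong (c +_) (∑-const xs c)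

  ∑-swap : (xs : List A) (ys : List C) (f : A → C → ℕ) →
    ∑ xs (λ x → ∑ ys (f x)) ≡ ∑ ys (λ y → ∑ xs (λ x → f x y))
  ∑-swap []       ys f = sym (trans (∑-const ys 0) (*-zeroʳ (length ys)))
  ∑-swap (x ∷ xs) ys f = trans (cong (∑ ys (f x) +_) (∑-swap xs ys f)) (sym (∑-+ ys (f x) _))

  ∑-concatMap : (g : A → List C) (xs : List A) (f : C → ℕ) → ∑ (concatMap g xs) f ≡ ∑ xs (λ x → ∑ (g x) f)
  ∑-concatMap g []       f = refl
  ∑-concatMap g (x ∷ xs) f = trans (∑-++ (g x) (concatMap g xs) f) (cong (∑ (g x) f +_) (∑-concatMap g xs f))

  ∑-filter : {P : A → Set} (P? : Decidable P) (xs : List A) (f : A → ℕ) →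
    ∑ (filter P? xs) f ≡ ∑ xs (λ x → ind (P? x) *ℕ f x)
  ∑-filter P? []       f = refl
  ∑-filter P? (x ∷ xs) f with P? x
  ... | yes _ = cong₂ _+_ (sym (+-identityʳ (f x))) (∑-filter P? xs f)
  ... | no _  = ∑-filter P? xs f

  length-filter-∑ : {P : A → Set} (P? : Decidable P) (xs : List A) →
    length (filter P? xs) ≡ ∑ xs (λ x → ind (P? x))
  length-filter-∑ P? []       = refl
  length-filter-∑ P? (x ∷ xs) with P? x
  ... | yes _ = cong suc (length-filter-∑ P? xs)
  ... | no _  = length-filter-∑ P? xs

  ∑-filter≤ : {P : A → Set} (P? : Decidable P) (xs : List A) (f : A → ℕ) → ∑ (filter P? xs) f ≤ ∑ xs f
  ∑-filter≤ P? []       f = z≤n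
  ∑-filter≤ P? (x ∷ xs) f with P? x
  ... | yes _ = +-monoʳ-≤ (f x) (∑-filter≤ P? xs f)
  ... | no _  = ≤-trans (∑-filter≤ P? xs f) (m≤n+m _ (f x))

  ∑-sublists-∷ : (x : A) (xs : List A) (F : List A → ℕ) →
    ∑ (sublists (x ∷ xs)) F ≡ ∑ (sublists xs) F + ∑ (sublists xs) (F ∘ (x ∷_))
  ∑-sublists-∷ x xs F = trans (∑-++ (sublists xs) _ F) (cong (∑ (sublists xs) F +_) (∑-map (x ∷_) (sublists xs) F))

  -- Applied with `P` the membership in a class: the defects `D` and the remaining part `T` become
  -- independent variables, so for fixed `D` the sets `T` can be counted freely.
  ∑-sublists-split : {P : A → Set} (P? : Decidable P) (xs : List A) (G : List A → List A → ℕ) →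
    ∑ (sublists xs) (λ S → G (filter (¬? ∘ P?) S) (filter P? S)) ≡
    ∑ (sublists (filter (¬? ∘ P?) xs)) (λ D → ∑ (sublists (filter P? xs)) (G D))
  ∑-sublists-split P? []       G = sym (+-identityʳ _)
  ∑-sublists-split P? (x ∷ xs) G rewrite ∑-sublists-∷ x xs (λ S → G (filter (¬? ∘ P?) S) (filter P? S)) with P? x
  ... | yes _ = begin
    _ ≡⟨ cong₂ _+_ (∑-sublists-split P? xs G) (∑-sublists-split P? xs (λ D T → G D (x ∷ T))) ⟩
    _ ≡⟨ ∑-+ (sublists (filter (¬? ∘ P?) xs)) _ _ ⟨
    _ ≡⟨ ∑-cong (sublists (filter (¬? ∘ P?) xs)) (λ D → sym (∑-sublists-∷ x (filter P? xs) (G D))) ⟩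
    _ ∎ where open ≡-Reasoning
  ... | no _ = begin
    _ ≡⟨ cong₂ _+_ (∑-sublists-split P? xs G) (∑-sublists-split P? xs (λ D T → G (x ∷ D) T)) ⟩
    _ ≡⟨ ∑-sublists-∷ x (filter (¬? ∘ P?) xs) _ ⟨
    _ ∎ where open ≡-Reasoning

  -- The sublists counted on the right are those of the part of `X` satisfying `Q`; the power of 2
  -- makes up for the choices lost at the other elements.
  ∑-sublists-all : {Q : A → Set} (Q? : Decidable Q) (X : List A) →
    2 ^ length X ≤ 2 ^ ∑ X (λ x → ind (¬? (Q? x))) *ℕ ∑ (sublists X) (λ T → ind (All.all? Q? T))
  ∑-sublists-all Q? [] = ≤-refl
  ∑-sublists-all {Q = Q} Q? (x ∷ X) = begin
    2 *ℕ 2 ^ length X ≤⟨ *-monoʳ-≤ 2 (∑-sublists-all Q? X) ⟩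
    2 *ℕ (2 ^ u *ℕ s) ≤⟨ split (Q? x) ⟩
    2 ^ (ind (¬? (Q? x)) + u) *ℕ (s + s′) ≡⟨ cong (2 ^ (ind (¬? (Q? x)) + u) *ℕ_) (∑-sublists-∷ x X _) ⟨
    _ ∎
    where
    open ≤-Reasoning
    u = ∑ X (λ x → ind (¬? (Q? x)))
    s = ∑ (sublists X) (λ T → ind (All.all? Q? T))
    s′ = ∑ (sublists X) (λ T → ind (All.all? Q? (x ∷ T)))
    lem : ∀ u s → 2 *ℕ (u *ℕ s) ≡ u *ℕ (s + s)
    lem = solve-∀
    split : Dec (Q x) → 2 *ℕ (2 ^ u *ℕ s) ≤ 2 ^ (ind (¬? (Q? x)) + u) *ℕ (s + s′)
    split (yes qx) rewrite ind-false (¬? (Q? x)) (λ ¬qx → ¬qx qx) = begin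
      2 *ℕ (2 ^ u *ℕ s) ≡⟨ lem (2 ^ u) s ⟩
      2 ^ u *ℕ (s + s) ≤⟨ *-monoʳ-≤ (2 ^ u) (+-monoʳ-≤ s
        (∑-mono (sublists X) λ T → ind-mono (All.all? Q? T) (All.all? Q? (x ∷ T)) (qx ∷_))) ⟩
      2 ^ u *ℕ (s + s′) ∎
    split (no ¬qx) rewrite ind-true (¬? (Q? x)) ¬qx = begin
      2 *ℕ (2 ^ u *ℕ s) ≡⟨ *-assoc 2 (2 ^ u) s ⟨
      2 *ℕ 2 ^ u *ℕ s ≤⟨ *-monoʳ-≤ (2 *ℕ 2 ^ u) (m≤m+n s s′) ⟩
      2 *ℕ 2 ^ u *ℕ (s + s′) ∎

  -- Ω b L F = Σ over D ⊆ L of b ^ |L ∖ D| · F D, that is, a sum with weight b ^ (− |D|) multiplied by b ^ |L|.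
  Ω : ℕ → List A → (List A → ℕ) → ℕ
  Ω b []      F = F []
  Ω b (x ∷ L) F = b *ℕ Ω b L F + Ω b L (F ∘ (x ∷_))

  Ω-mono : ∀ b (L : List A) {F G : List A → ℕ} → (∀ D → F D ≤ G D) → Ω b L F ≤ Ω b L G
  Ω-mono b []      p = p []
  Ω-mono b (x ∷ L) p = +-mono-≤ (*-monoʳ-≤ b (Ω-mono b L p)) (Ω-mono b L (p ∘ (x ∷_)))

  Ω-+ : ∀ b (L : List A) (F G : List A → ℕ) → Ω b L (λ D → F D + G D) ≡ Ω b L F + Ω b L G
  Ω-+ b []      F G = refl
  Ω-+ b (x ∷ L) F G =
    trans (cong₂ (λ s t → b *ℕ s + t) (Ω-+ b L F G) (Ω-+ b L (F ∘ (x ∷_)) (G ∘ (x ∷_))))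
          (lem b (Ω b L F) (Ω b L G) _ _)
    where
    lem : ∀ b f g f′ g′ → b *ℕ (f + g) + (f′ + g′) ≡ (b *ℕ f + f′) + (b *ℕ g + g′)
    lem = solve-∀

  Ω-* : ∀ b (L : List A) c (F : List A → ℕ) → Ω b L (λ D → c *ℕ F D) ≡ c *ℕ Ω b L F
  Ω-* b []      c F = refl
  Ω-* b (x ∷ L) c F =
    trans (cong₂ (λ s t → b *ℕ s + t) (Ω-* b L c F) (Ω-* b L c (F ∘ (x ∷_)))) (lem b c (Ω b L F) _)
    where
    lem : ∀ b c f f′ → b *ℕ (c *ℕ f) + c *ℕ f′ ≡ c *ℕ (b *ℕ f + f′)
    lem = solve-∀

  Ω-1 : ∀ b (L : List A) → Ω b L (λ _ → 1) ≡ suc b ^ length L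
  Ω-1 b []      = refl
  Ω-1 b (x ∷ L) rewrite Ω-1 b L = +-comm (b *ℕ suc b ^ length L) _

  -- A factor b ^ |D| cancels the weight, which leads from weighted back to plain sums over
  -- sublists.
  Ω-pow : ∀ b (L : List A) (F : List A → ℕ) → Ω b L (λ D → b ^ length D *ℕ F D) ≡ b ^ length L *ℕ ∑ (sublists L) F
  Ω-pow b []      F = cong (_+ 0) (sym (+-identityʳ (F [])))
  Ω-pow b (x ∷ L) F = begin
    b *ℕ Ω b L (λ D → b ^ length D *ℕ F D) + Ω b L (λ D → b *ℕ b ^ length D *ℕ F (x ∷ D))
      ≡⟨ cong₂ (λ s t → b *ℕ s + t) (Ω-pow b L F) (≤-antisym
           (Ω-mono b L λ D → ≤-reflexive (*-assoc b (b ^ length D) _))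
           (Ω-mono b L λ D → ≤-reflexive (sym (*-assoc b (b ^ length D) _)))) ⟩
    _ ≡⟨ cong (_ +_) (trans (Ω-* b L b _) (cong (b *ℕ_) (Ω-pow b L (F ∘ (x ∷_))))) ⟩
    b *ℕ (B *ℕ s) + b *ℕ (B *ℕ s′) ≡⟨ lem b B s s′ ⟩
    b *ℕ B *ℕ (s + s′) ≡⟨ cong (b *ℕ B *ℕ_) (∑-sublists-∷ x L F) ⟨
    _ ∎
    where
    open ≡-Reasoning
    B = b ^ length L
    s = ∑ (sublists L) F
    s′ = ∑ (sublists L) (F ∘ (x ∷_))
    lem : ∀ b B s s′ → b *ℕ (B *ℕ s) + b *ℕ (B *ℕ s′) ≡ b *ℕ B *ℕ (s + s′)
    lem = solve-∀

  -- Linearity of expectation: normalised by the total (b + 1) ^ |L|, the weight describes a random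
  -- `D` that contains each entry independently with probability 1/(b + 1).
  Ω-∑ : ∀ b (L : List A) (g : A → ℕ) → suc b *ℕ Ω b L (λ D → ∑ D g) ≡ ∑ L g *ℕ suc b ^ length L
  Ω-∑ b []      g = *-zeroʳ b
  Ω-∑ b (x ∷ L) g = begin
    suc b *ℕ (b *ℕ w + Ω b L (λ D → g x + ∑ D g))
      ≡⟨ cong (λ z → suc b *ℕ (b *ℕ w + z)) (trans (Ω-+ b L (λ _ → g x) (λ D → ∑ D g)) (cong (_+ w)
          (trans (cong (λ z → Ω b L (λ _ → z)) (sym (*-identityʳ (g x)))) (trans (Ω-* b L (g x) (λ _ → 1)) (cong (g x *ℕ_) (Ω-1 b L)))))) ⟩
    suc b *ℕ (b *ℕ w + (g x *ℕ G + w)) ≡⟨ lem₁ b w (g x) G ⟩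
    suc b *ℕ (suc b *ℕ w) + g x *ℕ (suc b *ℕ G) ≡⟨ cong (λ z → suc b *ℕ z + g x *ℕ (suc b *ℕ G)) (Ω-∑ b L g) ⟩
    suc b *ℕ (∑ L g *ℕ G) + g x *ℕ (suc b *ℕ G) ≡⟨ lem₂ (suc b) (g x) (∑ L g) G ⟩
    _ ∎
    where
    open ≡-Reasoning
    w = Ω b L (λ D → ∑ D g)
    G = suc b ^ length L
    lem₁ : ∀ b w g G → (1 + b) *ℕ (b *ℕ w + (g *ℕ G + w)) ≡ (1 + b) *ℕ ((1 + b) *ℕ w) + g *ℕ ((1 + b) *ℕ G)
    lem₁ = solve-∀
    lem₂ : ∀ c g s G → c *ℕ (s *ℕ G) + g *ℕ (c *ℕ G) ≡ (g + s) *ℕ (c *ℕ G)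
    lem₂ = solve-∀

  ∑∑-∷ : (x : A) (L : List A) (e : A → A → ℕ) →
    ∑ (x ∷ L) (λ u → ∑ (x ∷ L) (e u)) ≡ e x x + (∑ L (e x) + ∑ L (λ u → e u x)) + ∑ L (λ u → ∑ L (e u))
  ∑∑-∷ x L e = trans (cong (e x x + ∑ L (e x) +_) (∑-+ L (λ u → e u x) _))
    (lem (e x x) (∑ L (e x)) _ _)
    where
    lem : ∀ a b c d → a + b + (c + d) ≡ a + (b + c) + d
    lem = solve-∀

  -- Two different positions lie in the random `D` together with probability 1/(b + 1)². A diagonal
  -- term would have probability 1/(b + 1), which is why `e` has to vanish there.
  Ω-∑∑ : ∀ b (e : A → A → ℕ) → (∀ x → e x x ≡ 0) → (L : List A) →
    suc b *ℕ suc b *ℕ Ω b L (λ D → ∑ D λ u → ∑ D (e u)) ≡ ∑ L (λ u → ∑ L (e u)) *ℕ suc b ^ length L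
  Ω-∑∑ b e irr []      = *-zeroʳ (suc b *ℕ suc b)
  Ω-∑∑ b e irr (x ∷ L) = begin
    c *ℕ c *ℕ (b *ℕ w + Ω b L (λ D → ∑ (x ∷ D) λ u → ∑ (x ∷ D) (e u)))
      ≡⟨ cong (λ z → c *ℕ c *ℕ (b *ℕ w + z)) step ⟩
    c *ℕ c *ℕ (b *ℕ w + (p + q + w)) ≡⟨ lem₁ b w p q ⟩
    c *ℕ (c *ℕ p + c *ℕ q) + c *ℕ (c *ℕ c *ℕ w)
      ≡⟨ cong₂ (λ s t → c *ℕ s + c *ℕ t) (cong₂ _+_ (Ω-∑ b L (e x)) (Ω-∑ b L (λ u → e u x))) (Ω-∑∑ b e irr L) ⟩
    c *ℕ (P *ℕ G + Q *ℕ G) + c *ℕ (E *ℕ G) ≡⟨ lem₂ c P Q E G ⟩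
    (0 + (P + Q) + E) *ℕ (c *ℕ G) ≡⟨ cong (λ z → (z + (P + Q) + E) *ℕ (c *ℕ G)) (irr x) ⟨
    (e x x + (P + Q) + E) *ℕ (c *ℕ G) ≡⟨ cong (_*ℕ (c *ℕ G)) (∑∑-∷ x L e) ⟨
    _ ∎
    where
    open ≡-Reasoning
    c = suc b
    w = Ω b L (λ D → ∑ D λ u → ∑ D (e u))
    p = Ω b L (λ D → ∑ D (e x))
    q = Ω b L (λ D → ∑ D λ u → e u x)
    P = ∑ L (e x)
    Q = ∑ L λ u → e u x
    E = ∑ L λ u → ∑ L (e u)
    G = suc b ^ length L
    step : Ω b L (λ D → ∑ (x ∷ D) λ u → ∑ (x ∷ D) (e u)) ≡ p + q + w
    step = begin
      _ ≡⟨ ≤-antisym (Ω-mono b L λ D → ≤-reflexive (pt D)) (Ω-mono b L λ D → ≤-reflexive (sym (pt D))) ⟩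
      _ ≡⟨ Ω-+ b L _ _ ⟩
      _ ≡⟨ cong (_+ w) (Ω-+ b L _ _) ⟩
      p + q + w ∎
      where
      pt : ∀ D → ∑ (x ∷ D) (λ u → ∑ (x ∷ D) (e u)) ≡ (∑ D (e x) + ∑ D (λ u → e u x)) + ∑ D (λ u → ∑ D (e u))
      pt D = trans (∑∑-∷ x D e) (cong (λ z → z + (∑ D (e x) + ∑ D (λ u → e u x)) + ∑ D (λ u → ∑ D (e u))) (irr x))
    lem₁ : ∀ b w p q → (1 + b) *ℕ (1 + b) *ℕ (b *ℕ w + (p + q + w)) ≡
      (1 + b) *ℕ ((1 + b) *ℕ p + (1 + b) *ℕ q) + (1 + b) *ℕ ((1 + b) *ℕ (1 + b) *ℕ w)
    lem₁ = solve-∀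
    lem₂ : ∀ c P Q E G → c *ℕ (P *ℕ G + Q *ℕ G) + c *ℕ (E *ℕ G) ≡ (0 + (P + Q) + E) *ℕ (c *ℕ G)
    lem₂ = solve-∀

  -- Sums over pairs and Bonferroni's inequality

  pairs : List A → (A → A → ℕ) → ℕ
  pairs []      f = 0
  pairs (x ∷ L) f = ∑ L (f x) + pairs L f

  bonferroni : (L : List A) (f : A → ℕ) → (∀ x → f x ≤ 1) → ∑ L f ≤ 1 + pairs L (λ x y → f x *ℕ f y)
  bonferroni []      f f≤1 = z≤n
  bonferroni (x ∷ L) f f≤1 = begin
    f x + s ≤⟨ lem (f x) s (pairs L _) (f≤1 x) (bonferroni L f f≤1) ⟩
    1 + (f x *ℕ s + pairs L _) ≡⟨ cong (λ z → 1 + (z + pairs L _)) (∑-* L (f x) f) ⟨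
    _ ∎
    where
    open ≤-Reasoning
    s = ∑ L f
    lem : ∀ a s p → a ≤ 1 → s ≤ 1 + p → a + s ≤ 1 + (a *ℕ s + p)
    lem zero    s p _ h = h
    lem (suc zero) s p _ h = s≤s (≤-trans (≤-reflexive (sym (+-identityʳ s))) (m≤m+n (s + 0) p))
    lem (suc (suc a)) s p (s≤s ()) h

  pairs-∑ : (L : List A) (xs : List C) (f : C → A → A → ℕ) →
    ∑ xs (λ s → pairs L (f s)) ≡ pairs L (λ x y → ∑ xs (λ s → f s x y))
  pairs-∑ []      xs f = trans (∑-const xs 0) (*-zeroʳ (length xs))
  pairs-∑ (x ∷ L) xs f = trans (∑-+ xs (λ s → ∑ L (f s x)) (λ s → pairs L (f s)))
    (cong₂ _+_ (∑-swap xs L (λ s → f s x)) (pairs-∑ L xs f))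

  ∑-bound : {L : List A} {f : A → ℕ} {c : ℕ} → All (λ x → f x ≤ c) L → ∑ L f ≤ length L *ℕ c
  ∑-bound []       = z≤n
  ∑-bound (p ∷ ps) = +-mono-≤ p (∑-bound ps)

  pairs-bound : {L : List A} {f : A → A → ℕ} {c : ℕ} → AllPairs (λ x y → f x y ≤ c) L → pairs L f ≤ length L *ℕ (length L *ℕ c)
  pairs-bound [] = z≤n
  pairs-bound {L = x ∷ L} {f} {c} (p ∷ ps) = begin
    ∑ L (f x) + pairs L f ≤⟨ +-mono-≤ (∑-bound p) (pairs-bound ps) ⟩
    l *ℕ c + l *ℕ (l *ℕ c) ≤⟨ m≤m+n _ (c + l *ℕ c) ⟩
    _ ≡⟨ lem l c ⟩
    (1 + l) *ℕ ((1 + l) *ℕ c) ∎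
    where
    open ≤-Reasoning
    l = length L
    lem : ∀ l c → l *ℕ c + l *ℕ (l *ℕ c) + (c + l *ℕ c) ≡ (1 + l) *ℕ ((1 + l) *ℕ c)
    lem = solve-∀

  -- Exponential Markov inequality: an element of Q in S costs a factor 1/16.
  ∑-sublists-few : {Q : A → Set} (Q? : Decidable Q) (V : List A) (s : ℕ) →
    16 ^ length V *ℕ ∑ (sublists V) (λ S → ind (∑ S (λ x → ind (Q? x)) ≤? s)) ≤
    16 ^ s *ℕ (17 ^ length V *ℕ 2 ^ ∑ V (λ x → ind (¬? (Q? x))))
  ∑-sublists-few Q? [] s = begin
    1 ≤⟨ m^n>0 16 s ⟩
    16 ^ s ≡⟨ *-identityʳ _ ⟨
    16 ^ s *ℕ 1 ∎
    where open ≤-Reasoning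
  ∑-sublists-few {A = A} Q? (x ∷ V) s rewrite ∑-sublists-∷ x V (λ S → ind (∑ S (λ x → ind (Q? x)) ≤? s)) with Q? x
  ... | no _ = begin
    16 *ℕ b *ℕ (σ s + σ s) ≡⟨ lem₁ b (σ s) ⟩
    32 *ℕ (b *ℕ σ s) ≤⟨ *-monoʳ-≤ 32 (∑-sublists-few Q? V s) ⟩
    32 *ℕ (16 ^ s *ℕ (17 ^ length V *ℕ w)) ≤⟨ m≤n+m _ (2 *ℕ (16 ^ s *ℕ (17 ^ length V *ℕ w))) ⟩
    _ ≡⟨ lem₂ (16 ^ s) (17 ^ length V) w ⟩
    16 ^ s *ℕ (17 *ℕ 17 ^ length V *ℕ (2 *ℕ w)) ∎
    where
    open ≤-Reasoning
    b = 16 ^ length V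
    σ : ℕ → ℕ
    σ s = ∑ (sublists V) (λ S → ind (∑ S (λ x → ind (Q? x)) ≤? s))
    w = 2 ^ ∑ V (λ x → ind (¬? (Q? x)))
    lem₁ : ∀ b s → 16 *ℕ b *ℕ (s + s) ≡ 32 *ℕ (b *ℕ s)
    lem₁ = solve-∀
    lem₂ : ∀ a c w → 2 *ℕ (a *ℕ (c *ℕ w)) + 32 *ℕ (a *ℕ (c *ℕ w)) ≡ a *ℕ (17 *ℕ c *ℕ (2 *ℕ w))
    lem₂ = solve-∀
  -- Leaving `x` out keeps the budget `s`, and taking it lowers the budget by one at the price 1/16;
  -- together 1 + 1/16 = 17/16. With budget 0 only the first option remains.
  ... | yes _ = go s
    where
    open ≤-Reasoning
    b = 16 ^ length V
    σ : ℕ → ℕ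
    σ s = ∑ (sublists V) (λ S → ind (∑ S (λ x → ind (Q? x)) ≤? s))
    w = 2 ^ ∑ V (λ x → ind (¬? (Q? x)))
    lem₀ : ∀ b s → 16 *ℕ b *ℕ (s + 0) ≡ 16 *ℕ (b *ℕ s)
    lem₀ = solve-∀
    lem₁ : ∀ b s p → 16 *ℕ b *ℕ (s + p) ≡ 16 *ℕ (b *ℕ s) + 16 *ℕ (b *ℕ p)
    lem₁ = solve-∀
    lem₂ : ∀ a c w → a *ℕ (c *ℕ w) + 16 *ℕ (a *ℕ (c *ℕ w)) ≡ a *ℕ (17 *ℕ c *ℕ w)
    lem₂ = solve-∀
    lem₃ : ∀ a c w → 16 *ℕ (16 *ℕ a *ℕ (c *ℕ w)) + 16 *ℕ (a *ℕ (c *ℕ w)) ≡ 16 *ℕ a *ℕ (17 *ℕ c *ℕ w)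
    lem₃ = solve-∀
    σ′ : ℕ → ℕ
    σ′ s = ∑ (sublists V) (λ S → ind (suc (∑ S (λ x → ind (Q? x))) ≤? s))
    go : ∀ s → 16 *ℕ b *ℕ (σ s + σ′ s)
       ≤ 16 ^ s *ℕ (17 *ℕ 17 ^ length V *ℕ w)
    go zero = begin
      16 *ℕ b *ℕ (σ 0 + σ′ 0) ≡⟨ cong (λ z → 16 *ℕ b *ℕ (σ 0 + z))
        (trans (∑-cong (sublists V) (λ S → ind-false (suc (∑ S (λ x → ind (Q? x))) ≤? 0) λ ()))
            (trans (∑-const (sublists V) 0) (*-zeroʳ (length (sublists V))))) ⟩
      16 *ℕ b *ℕ (σ 0 + 0) ≡⟨ lem₀ b (σ 0) ⟩
      16 *ℕ (b *ℕ σ 0) ≤⟨ *-monoʳ-≤ 16 (∑-sublists-few Q? V 0) ⟩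
      16 *ℕ (1 *ℕ (17 ^ length V *ℕ w)) ≤⟨ m≤n+m _ (1 *ℕ (17 ^ length V *ℕ w)) ⟩
      _ ≡⟨ lem₂ 1 (17 ^ length V) w ⟩
      _ ∎
    go (suc s) = begin
      16 *ℕ b *ℕ (σ (suc s) + σ′ (suc s)) ≤⟨ *-monoʳ-≤ (16 *ℕ b) (+-monoʳ-≤ (σ (suc s))
         (∑-mono (sublists V) λ S → ind-mono (suc (∑ S _) ≤? suc s) (∑ S _ ≤? s) λ { (s≤s p) → p })) ⟩
      16 *ℕ b *ℕ (σ (suc s) + σ s) ≡⟨ lem₁ b (σ (suc s)) (σ s) ⟩
      16 *ℕ (b *ℕ σ (suc s)) + 16 *ℕ (b *ℕ σ s)
        ≤⟨ +-mono-≤ (*-monoʳ-≤ 16 (∑-sublists-few Q? V (suc s))) (*-monoʳ-≤ 16 (∑-sublists-few Q? V s)) ⟩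
      _ ≡⟨ lem₃ (16 ^ s) (17 ^ length V) w ⟩
      _ ∎

  -- Affine colourings of the torus

  Step : Fin 3 → Fin 3 → Set
  Step x y = toℕ x ≡ (toℕ y + 1) % 3 ⊎ toℕ y ≡ (toℕ x + 1) % 3

  step-irrefl : ∀ x → ¬ Step x x
  step-irrefl zero (inj₁ ())
  step-irrefl zero (inj₂ ())
  step-irrefl (suc zero) (inj₁ ())
  step-irrefl (suc zero) (inj₂ ())
  step-irrefl (suc (suc zero)) (inj₁ ())
  step-irrefl (suc (suc zero)) (inj₂ ())

  adjacent-sym : ∀ n {u v} → Adjacent 3 n u v → Adjacent 3 n v u
  adjacent-sym n (j , s , e) = j , swap s , λ i i≢j → sym (e i i≢j)

  adjacent-irrefl : ∀ n u → ¬ Adjacent 3 n u u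
  adjacent-irrefl n u (j , s , _) = step-irrefl (lookup u j) s

  adjacent-∷ : ∀ n {x y u w} → Adjacent 3 (suc n) (x ∷ u) (y ∷ w) →
    (x ≢ y × u ≡ w) ⊎ (x ≡ y × Adjacent 3 n u w)
  adjacent-∷ n {x} {u = u} {w} (zero , s , e) =
    inj₁ ((λ { refl → step-irrefl x s }) , Pointwise-≡⇒≡ (ext λ i → e (suc i) λ ()))
  adjacent-∷ n (suc j , s , e) = inj₂ (e zero (λ ()) , j , s , λ i i≢j → e (suc i) (i≢j ∘ suc-injective))

  rot : Fin 3 → Fin 3
  rot zero             = suc zero
  rot (suc zero)       = suc (suc zero)
  rot (suc (suc zero)) = zero

  -- shift true x z = z + x and shift false x z = z − x modulo 3.
  shift : Bool → Fin 3 → Fin 3 → Fin 3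
  shift b     zero             z = z
  shift true  (suc zero)       z = rot z
  shift true  (suc (suc zero)) z = rot (rot z)
  shift false (suc zero)       z = rot (rot z)
  shift false (suc (suc zero)) z = rot z

  ∑₃ : (Fin 3 → ℕ) → ℕ
  ∑₃ = ∑ (allFin 3)

  shift-hits : ∀ b z x → ∑₃ (λ y → ind (shift b y z ≟ᶠ x)) ≡ 1
  shift-hits true  = from-yes (allᶠ? λ z → allᶠ? λ x → ∑₃ (λ y → ind (shift true y z ≟ᶠ x)) ≟ 1)
  shift-hits false = from-yes (allᶠ? λ z → allᶠ? λ x → ∑₃ (λ y → ind (shift false y z ≟ᶠ x)) ≟ 1)

  -- With opposite signs the equation reads 2y ≡ ±(z′ - z), and 2 is invertible modulo 3.
  shift-agree : ∀ b b′ → b ≢ b′ → ∀ z z′ → ∑₃ (λ y → ind (shift b y z ≟ᶠ shift b′ y z′)) ≡ 1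
  shift-agree true true b≢b = ⊥-elim (b≢b refl)
  shift-agree false false b≢b = ⊥-elim (b≢b refl)
  shift-agree true false _ =
    from-yes (allᶠ? λ z → allᶠ? λ z′ → ∑₃ (λ y → ind (shift true y z ≟ᶠ shift false y z′)) ≟ 1)
  shift-agree false true _ =
    from-yes (allᶠ? λ z → allᶠ? λ z′ → ∑₃ (λ y → ind (shift false y z ≟ᶠ shift true y z′)) ≟ 1)

  shift-not : ∀ b y z → shift (not b) y (shift b y z) ≡ z
  shift-not true  = from-yes (allᶠ? λ y → allᶠ? λ z → shift false y (shift true y z) ≟ᶠ z)
  shift-not false = from-yes (allᶠ? λ y → allᶠ? λ z → shift true y (shift false y z) ≟ᶠ z)

  shift-injective : ∀ b y {z z′} → shift b y z ≡ shift b y z′ → z ≡ z′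
  shift-injective b y {z} {z′} eq = trans (sym (shift-not b y z)) (trans (cong (shift (not b) y) eq) (shift-not b y z′))

  shift-injectiveˡ : ∀ b z x y → shift b x z ≡ shift b y z → x ≡ y
  shift-injectiveˡ true  = from-yes (allᶠ? λ z → allᶠ? λ x → allᶠ? λ y → (shift true x z ≟ᶠ shift true y z) →-dec (x ≟ᶠ y))
  shift-injectiveˡ false = from-yes (allᶠ? λ z → allᶠ? λ x → allᶠ? λ y → (shift false x z ≟ᶠ shift false y z) →-dec (x ≟ᶠ y))

  -- The affine form c ± u₁ ± ... ± uₙ modulo 3, where `true` in the sign vector stands for plus.
  colour : ∀ {n} → Vec Bool n → Fin 3 → Vertex 3 n → Fin 3
  colour []      c []      = c
  colour (b ∷ a) c (x ∷ u) = shift b x (colour a c u)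

  colour-proper : ∀ {n} (a : Vec Bool n) c {u v} → Adjacent 3 n u v → colour a c u ≢ colour a c v
  colour-proper [] c (() , _)
  colour-proper (b ∷ a) c {x ∷ u} {y ∷ v} adj eq with adjacent-∷ _ adj
  ... | inj₁ (x≢y , refl) = x≢y (shift-injectiveˡ b (colour a c u) x y eq)
  ... | inj₂ (refl , adj′) = colour-proper a c adj′ (shift-injective b x eq)

  ∑-vertices : ∀ n (F : Vertex 3 (suc n) → ℕ) →
    ∑ (vertices 3 (suc n)) F ≡ ∑ (vertices 3 n) (λ v → ∑₃ (λ x → F (x ∷ v)))
  ∑-vertices n F = ∑-concatMap (λ v → map (_∷ v) (allFin 3)) (vertices 3 n) F

  length-vertices : ∀ n → length (vertices 3 n) ≡ 3 ^ n
  length-vertices n = trans (sym (trans (∑-const (vertices 3 n) 1) (*-identityʳ _))) (go n)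
    where
    go : ∀ n → ∑ (vertices 3 n) (λ _ → 1) ≡ 3 ^ n
    go zero = refl
    go (suc n) = trans (∑-vertices n _) (trans (∑-* (vertices 3 n) 3 (λ _ → 1)) (cong (3 *ℕ_) (go n)))

  _≟ᵛ_ : ∀ {n} (u v : Vertex 3 n) → Dec (u ≡ v)
  _≟ᵛ_ = ≡-dec _≟ᶠ_

  ∑₃-≟ : ∀ x → ∑₃ (λ y → ind (x ≟ᶠ y)) ≡ 1
  ∑₃-≟ = from-yes (allᶠ? λ x → ∑₃ (λ y → ind (x ≟ᶠ y)) ≟ 1)

  ∑-vertices-≟ : ∀ {n} (u : Vertex 3 n) → ∑ (vertices 3 n) (λ v → ind (u ≟ᵛ v)) ≤ 1
  ∑-vertices-≟ {zero} [] = ≤-refl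
  ∑-vertices-≟ {suc n} (x ∷ u) = begin
    ∑ (vertices 3 (suc n)) (λ v → ind ((x ∷ u) ≟ᵛ v)) ≡⟨ ∑-vertices n _ ⟩
    ∑ (vertices 3 n) (λ v → ∑₃ λ y → ind ((x ∷ u) ≟ᵛ (y ∷ v)))
      ≤⟨ ∑-mono (vertices 3 n) (λ v → ≤-trans (∑-mono (allFin 3) (pt v)) (≤-reflexive
          (trans (∑-* (allFin 3) (ind (u ≟ᵛ v)) (λ y → ind (x ≟ᶠ y))) (trans (cong (ind (u ≟ᵛ v) *ℕ_) (∑₃-≟ x)) (*-identityʳ _))))) ⟩
    ∑ (vertices 3 n) (λ v → ind (u ≟ᵛ v)) ≤⟨ ∑-vertices-≟ u ⟩
    1 ∎
    where
    open ≤-Reasoning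
    pt : ∀ v y → ind ((x ∷ u) ≟ᵛ (y ∷ v)) ≤ ind (u ≟ᵛ v) *ℕ ind (x ≟ᶠ y)
    pt v y = ind-elim ((x ∷ u) ≟ᵛ (y ∷ v)) λ { refl →
      ≤-reflexive (sym (cong₂ _*ℕ_ (ind-true (u ≟ᵛ u) refl) (ind-true (x ≟ᶠ x) refl))) }

  -- Along a line in a coordinate direction the colour takes each value once, so each direction
  -- supplies at most one neighbour of colour `x`. The induction splits off the first coordinate;
  -- neighbours sharing it are counted in dimension n, with the target `x` moved back by the
  -- contribution of `y₀`.
  colour-degree : ∀ {n} (a : Vec Bool n) c x u →
    ∑ (vertices 3 n) (λ v → ind (adjacent? 3 n u v) *ℕ ind (colour a c v ≟ᶠ x)) ≤ n
  colour-degree [] c x [] = ≤-refl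
  colour-degree {suc n} (b ∷ a) c x (y₀ ∷ u) = begin
    ∑ (vertices 3 (suc n)) F ≡⟨ ∑-vertices n F ⟩
    ∑ V (λ w → ∑₃ λ y → F (y ∷ w)) ≤⟨ ∑-mono V (λ w → ∑-mono (allFin 3) (pt w)) ⟩
    ∑ V (λ w → ∑₃ λ y → ind (u ≟ᵛ w) *ℕ k y + h w *ℕ ind (y₀ ≟ᶠ y))
      ≡⟨ ∑-cong V (λ w → trans (∑-+ (allFin 3) (λ y → ind (u ≟ᵛ w) *ℕ k y) (λ y → h w *ℕ ind (y₀ ≟ᶠ y)))
           (cong₂ _+_ (trans (∑-* (allFin 3) (ind (u ≟ᵛ w)) k)
               (trans (cong (ind (u ≟ᵛ w) *ℕ_) (shift-hits b (colour a c u) x)) (*-identityʳ (ind (u ≟ᵛ w)))))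
                      (trans (∑-* (allFin 3) (h w) (λ y → ind (y₀ ≟ᶠ y))) (trans (cong (h w *ℕ_) (∑₃-≟ y₀)) (*-identityʳ (h w)))))) ⟩
    ∑ V (λ w → ind (u ≟ᵛ w) + h w) ≡⟨ ∑-+ V (λ w → ind (u ≟ᵛ w)) h ⟩
    ∑ V (λ w → ind (u ≟ᵛ w)) + ∑ V h ≤⟨ +-mono-≤ (∑-vertices-≟ u) (colour-degree a c (shift (not b) y₀ x) u) ⟩
    1 + n ∎
    where
    open ≤-Reasoning
    V = vertices 3 n
    F : Vertex 3 (suc n) → ℕ
    F v = ind (adjacent? 3 (suc n) (y₀ ∷ u) v) *ℕ ind (colour (b ∷ a) c v ≟ᶠ x)
    k : Fin 3 → ℕ
    k y = ind (shift b y (colour a c u) ≟ᶠ x)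
    h : Vertex 3 n → ℕ
    h w = ind (adjacent? 3 n u w) *ℕ ind (colour a c w ≟ᶠ shift (not b) y₀ x)
    pt : ∀ w y → F (y ∷ w) ≤ ind (u ≟ᵛ w) *ℕ k y + h w *ℕ ind (y₀ ≟ᶠ y)
    pt w y = ind-*-elim (adjacent? 3 (suc n) (y₀ ∷ u) (y ∷ w)) (shift b y (colour a c w) ≟ᶠ x) λ adj eq → hit adj eq (adjacent-∷ n adj)
      where
      hit : Adjacent 3 (suc n) (y₀ ∷ u) (y ∷ w) → shift b y (colour a c w) ≡ x →
        (y₀ ≢ y × u ≡ w) ⊎ (y₀ ≡ y × Adjacent 3 n u w) → 1 ≤ ind (u ≟ᵛ w) *ℕ k y + h w *ℕ ind (y₀ ≟ᶠ y)
      hit _ eq (inj₁ (_ , refl)) = ≤-trans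
        (≤-reflexive (sym (cong₂ _*ℕ_ (ind-true (u ≟ᵛ u) refl) (ind-true (shift b y (colour a c u) ≟ᶠ x) eq)))) (m≤m+n _ _)
      hit _ eq (inj₂ (refl , adj)) = ≤-trans
        (≤-reflexive (sym (cong₂ _*ℕ_ (cong₂ _*ℕ_ (ind-true (adjacent? 3 n u w) adj)
          (ind-true (colour a c w ≟ᶠ shift (not b) y₀ x) (trans (sym (shift-not b y₀ _)) (cong (shift (not b) y₀) eq))))
          (ind-true (y₀ ≟ᶠ y₀) refl)))) (m≤n+m _ _)

  colour-class-size : ∀ {n} b (a : Vec Bool n) c x →
    ∑ (vertices 3 (suc n)) (λ v → ind (colour (b ∷ a) c v ≟ᶠ x)) ≡ 3 ^ n
  colour-class-size {n} b a c x = begin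
    _ ≡⟨ ∑-vertices n _ ⟩
    _ ≡⟨ ∑-cong (vertices 3 n) (λ w → shift-hits b (colour a c w) x) ⟩
    _ ≡⟨ ∑-const (vertices 3 n) 1 ⟩
    _ ≡⟨ *-identityʳ _ ⟩
    _ ≡⟨ length-vertices n ⟩
    3 ^ n ∎
    where open ≡-Reasoning

  -- If the first signs differ, exactly one of the three values of the first coordinate gives
  -- agreement, whatever the rest. If they are equal, that coordinate drops out; when all signs are
  -- equal the constants differ and there is no agreement at all.
  colour-agree : ∀ {n} (a a′ : Vec Bool n) c c′ → (a , c) ≢ (a′ , c′) →
    3 *ℕ ∑ (vertices 3 n) (λ u → ind (colour a c u ≟ᶠ colour a′ c′ u)) ≤ 3 ^ n
  colour-agree [] [] c c′ ne = begin
    3 *ℕ (ind (c ≟ᶠ c′) + 0) ≡⟨ cong (λ z → 3 *ℕ (z + 0)) (ind-false (c ≟ᶠ c′) (ne ∘ cong ([] ,_))) ⟩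
    0 ≤⟨ z≤n ⟩
    1 ∎
    where open ≤-Reasoning
  colour-agree {suc n} (b ∷ a) (b′ ∷ a′) c c′ ne with b ≟ᵇ b′
  ... | no b≢b′ = *-monoʳ-≤ 3 (≤-reflexive (begin
    _ ≡⟨ ∑-vertices n _ ⟩
    _ ≡⟨ ∑-cong (vertices 3 n) (λ w → shift-agree b b′ b≢b′ (colour a c w) (colour a′ c′ w)) ⟩
    _ ≡⟨ ∑-const (vertices 3 n) 1 ⟩
    _ ≡⟨ *-identityʳ _ ⟩
    _ ≡⟨ length-vertices n ⟩
    3 ^ n ∎))
    where open ≡-Reasoning
  ... | yes refl = *-monoʳ-≤ 3 (begin
    _ ≡⟨ ∑-vertices n _ ⟩
    _ ≤⟨ ∑-mono (vertices 3 n) (λ w → ∑-mono (allFin 3) (λ y →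
          ind-mono (shift b y (colour a c w) ≟ᶠ shift b y (colour a′ c′ w)) (colour a c w ≟ᶠ colour a′ c′ w) (shift-injective b y))) ⟩
    _ ≡⟨ ∑-* (vertices 3 n) 3 _ ⟩
    _ ≤⟨ colour-agree a a′ c c′ (λ { refl → ne refl }) ⟩
    3 ^ n ∎)
    where open ≤-Reasoning

  -- The family of classes and their overlaps

  length-cartesianProductWith : {A B C : Set} (f : A → B → C) (xs : List A) (ys : List B) →
    length (cartesianProductWith f xs ys) ≡ length xs *ℕ length ys
  length-cartesianProductWith f []       ys = refl
  length-cartesianProductWith f (x ∷ xs) ys = trans (length-++ (map (f x) ys))
    (cong₂ _+_ (length-map (f x) ys) (length-cartesianProductWith f xs ys))

  signs : ∀ n → List (Vec Bool n)
  signs zero    = [] ∷ []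
  signs (suc n) = cartesianProductWith _∷_ (true ∷ false ∷ []) (signs n)

  length-signs : ∀ n → length (signs n) ≡ 2 ^ n
  length-signs zero    = refl
  length-signs (suc n) = trans (length-cartesianProductWith _∷_ (true ∷ false ∷ []) (signs n)) (cong (2 *ℕ_) (length-signs n))

  signs-unique : ∀ n → Unique (signs n)
  signs-unique zero    = [] ∷ []
  signs-unique (suc n) = cartesianProductWith⁺ _∷_ ∷-injective (((λ ()) ∷ []) ∷ [] ∷ []) (signs-unique n)

  classes : ∀ n → List (Vec Bool n × Fin 3)
  classes n = cartesianProduct (signs n) (allFin 3)

  length-classes : ∀ n → length (classes n) ≡ 3 *ℕ 2 ^ n
  length-classes n = trans (length-cartesianProductWith _,_ (signs n) (allFin 3)) (trans (cong (_*ℕ 3) (length-signs n)) (*-comm (2 ^ n) 3))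

  classes-unique : ∀ n → Unique (classes n)
  classes-unique n = cartesianProduct⁺ (signs-unique n) (allFin⁺ 3)

  -- Fixing the first sign picks one of the two sign vectors ±a defining the same independent sets.
  InClass : ∀ {n} → Vec Bool n × Fin 3 → Vertex 3 (suc n) → Set
  InClass (a , c) v = colour (true ∷ a) c v ≡ zero

  inClass? : ∀ {n} (p : Vec Bool n × Fin 3) v → Dec (InClass p v)
  inClass? (a , c) v = colour (true ∷ a) c v ≟ᶠ zero

  -- Both forms contain the first coordinate with sign plus, so each `w` extends to one vertex of
  -- each class, and to a common one only where the two remaining forms agree.
  class-overlap : ∀ {n} (p p′ : Vec Bool n × Fin 3) → p ≢ p′ →
    3 *ℕ ∑ (vertices 3 (suc n)) (λ v → ind (inClass? p v ×-dec inClass? p′ v)) ≤ 3 ^ n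
  class-overlap {n} p@(a , c) p′@(a′ , c′) ne = begin
    _ ≡⟨ cong (3 *ℕ_) (∑-vertices n _) ⟩
    _ ≤⟨ *-monoʳ-≤ 3 (∑-mono (vertices 3 n) λ w → ov w (colour a c w ≟ᶠ colour a′ c′ w)) ⟩
    _ ≤⟨ colour-agree a a′ c c′ ne ⟩
    3 ^ n ∎
    where
    open ≤-Reasoning
    ov : ∀ w → (d : Dec (colour a c w ≡ colour a′ c′ w)) → ∑₃ (λ y → ind (inClass? p (y ∷ w) ×-dec inClass? p′ (y ∷ w))) ≤ ind d
    ov w (yes _) = ≤-trans (∑-mono (allFin 3) λ y → ind-mono (inClass? p (y ∷ w) ×-dec inClass? p′ (y ∷ w)) (inClass? p (y ∷ w)) proj₁)
      (≤-reflexive (shift-hits true (colour a c w) zero))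
    ov w (no ¬e) = ≤-reflexive (trans (∑-cong (allFin 3) λ y →
      ind-false (inClass? p (y ∷ w) ×-dec inClass? p′ (y ∷ w)) λ (e , e′) → ¬e (shift-injective true y (trans e (sym e′))))
      refl)

  -- Independent sets near a large independent class

  ind-¬¬ : {P : Set} (p : Dec P) → ind (¬? (¬? p)) ≡ ind p
  ind-¬¬ (yes _) = refl
  ind-¬¬ (no _)  = refl

  ind-¬ : {P : Set} (p : Dec P) → 1 ≤ ind p + ind (¬? p)
  ind-¬ (yes _) = ≤-refl
  ind-¬ (no _)  = ≤-refl

  ind-¬all : {A : Set} {P : A → Set} (P? : Decidable P) (D : List A) →
    ind (¬? (All.all? P? D)) ≤ ∑ D (λ v → ind (¬? (P? v)))
  ind-¬all P? [] = ≤-refl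
  ind-¬all {P = P} P? (v ∷ D) = go (P? v)
    where
    go : Dec (P v) → ind (¬? (All.all? P? (v ∷ D))) ≤ ind (¬? (P? v)) + ∑ D (λ v → ind (¬? (P? v)))
    go (yes p) = ≤-trans (ind-mono (¬? (All.all? P? (v ∷ D))) (¬? (All.all? P? D)) λ ¬all all → ¬all (p ∷ all))
      (≤-trans (ind-¬all P? D) (m≤n+m _ _))
    go (no ¬p) = ≤-trans (ind≤1 (¬? (All.all? P? (v ∷ D)))) (≤-trans (≤-reflexive (sym (ind-true (¬? (P? v)) ¬p))) (m≤m+n _ _))

  length-sublists : {A : Set} (L : List A) → ∑ (sublists L) (λ _ → 1) ≡ 2 ^ length L
  length-sublists []      = refl
  length-sublists (x ∷ L) = trans (∑-sublists-∷ x L _)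
    (trans (cong₂ _+_ (length-sublists L) (length-sublists L)) (cong (2 ^ length L +_) (sym (+-identityʳ _))))

  module IndependentSets {A : Set} (Adj : A → A → Set) (adj? : ∀ u v → Dec (Adj u v))
    (adj-sym : ∀ {u v} → Adj u v → Adj v u) (adj-irrefl : ∀ u → ¬ Adj u u) (V : List A) where

    Indep : List A → Set
    Indep S = All (λ u → All (λ v → ¬ Adj u v) S) S

    indep? : ∀ S → Dec (Indep S)
    indep? S = All.all? (λ u → All.all? (λ v → ¬? (adj? u v)) S) S

    module NearClass (M : A → Set) (M? : ∀ u → Dec (M u)) (t : ℕ) where

      defects : List A → ℕ
      defects S = ∑ S (λ x → ind (¬? (M? x)))

      near : List A → ℕ
      near S = ind (indep? S) *ℕ ind (defects S ≤? t)

      module LowerBound (M-indep : ∀ {u v} → M u → M v → ¬ Adj u v) (n d : ℕ)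
        (degree : ∀ u → ∑ V (λ v → ind (M? v) *ℕ ind (adj? u v)) ≤ n)
        (codegree : ∀ u → ∑ V (λ v → ind (¬? (M? v)) *ℕ ind (adj? u v)) ≤ d) where

        X W : List A
        X = filter M? V
        W = filter (¬? ∘ M?) V

        b : ℕ
        b = 2 ^ n

        ok tail edges : List A → ℕ
        ok D    = ind (indep? D) *ℕ ind (length D ≤? t)
        tail D  = ind (¬? (length D ≤? t))
        edges D = ∑ D λ u → ∑ D λ v → ind (adj? u v)

        avoid? : ∀ D u → Dec (All (λ v → ¬ Adj v u) D)
        avoid? D u = All.all? (λ v → ¬? (adj? v u)) D

        -- A lower bound for `near` with the defects and the rest as separate arguments, in the
        -- shape that `∑-sublists-split` asks for.
        G : List A → List A → ℕ
        G D T = ok D *ℕ ind (All.all? (avoid? D) T)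

        indep-union : ∀ S → Indep (filter (¬? ∘ M?) S) →
          All (λ u → All (λ v → ¬ Adj v u) (filter (¬? ∘ M?) S)) (filter M? S) → Indep S
        indep-union S ind-D avoid = All.tabulate λ {u} u∈ → All.tabulate λ {v} v∈ → pair u∈ v∈ (M? u) (M? v)
          where
          pair : ∀ {u v} → u ∈ S → v ∈ S → Dec (M u) → Dec (M v) → ¬ Adj u v
          pair u∈ v∈ (yes mu) (yes mv) = M-indep mu mv
          pair u∈ v∈ (yes mu) (no ¬mv) =
            All.lookup (All.lookup avoid (∈-filter⁺ M? u∈ mu)) (∈-filter⁺ (¬? ∘ M?) v∈ ¬mv) ∘ adj-sym
          pair u∈ v∈ (no ¬mu) (yes mv) =
            All.lookup (All.lookup avoid (∈-filter⁺ M? v∈ mv)) (∈-filter⁺ (¬? ∘ M?) u∈ ¬mu)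
          pair u∈ v∈ (no ¬mu) (no ¬mv) =
            All.lookup (All.lookup ind-D (∈-filter⁺ (¬? ∘ M?) u∈ ¬mu)) (∈-filter⁺ (¬? ∘ M?) v∈ ¬mv)

        G≤near : ∀ S → G (filter (¬? ∘ M?) S) (filter M? S) ≤ near S
        G≤near S = go (indep? D) (length D ≤? t) (All.all? (avoid? D) (filter M? S))
          where
          D = filter (¬? ∘ M?) S
          go : (p : Dec (Indep D)) (q : Dec (length D ≤ t)) (r : Dec (All (λ u → All (λ v → ¬ Adj v u) D) (filter M? S))) →
            ind p *ℕ ind q *ℕ ind r ≤ near S
          go (no _)  _       _       = z≤n
          go (yes _) (no _)  _       = z≤n
          go (yes _) (yes _) (no _)  = z≤n
          go (yes p) (yes q) (yes r) = ≤-reflexive (sym (cong₂ _*ℕ_ (ind-true (indep? S) (indep-union S p r))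
            (ind-true (defects S ≤? t) (subst (_≤ t) (length-filter-∑ (¬? ∘ M?) S) q))))

        extensions : ∀ D → 2 ^ length X *ℕ ok D ≤ b ^ length D *ℕ ∑ (sublists X) (G D)
        extensions D = begin
          2 ^ length X *ℕ ok D ≤⟨ *-monoˡ-≤ (ok D) (∑-sublists-all (avoid? D) X) ⟩
          2 ^ k *ℕ s *ℕ ok D ≤⟨ *-monoˡ-≤ (ok D) (*-monoˡ-≤ s (^-monoʳ-≤ 2 k≤)) ⟩
          2 ^ (n *ℕ length D) *ℕ s *ℕ ok D ≡⟨ cong (λ z → z *ℕ s *ℕ ok D) (^-*-assoc 2 n (length D)) ⟨
          b ^ length D *ℕ s *ℕ ok D ≡⟨ trans (*-assoc (b ^ length D) s (ok D)) (cong (b ^ length D *ℕ_) (*-comm s (ok D))) ⟩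
          b ^ length D *ℕ (ok D *ℕ s) ≡⟨ cong (b ^ length D *ℕ_) (∑-* (sublists X) (ok D) (λ T → ind (All.all? (avoid? D) T))) ⟨
          b ^ length D *ℕ ∑ (sublists X) (G D) ∎
          where
          open ≤-Reasoning
          s = ∑ (sublists X) (λ T → ind (All.all? (avoid? D) T))
          k = ∑ X (λ u → ind (¬? (avoid? D u)))
          -- A blocked element of `X` has a neighbour in `D`; counting these adjacencies from the
          -- side of `D` bounds the number of blocked elements.
          k≤ : k ≤ n *ℕ length D
          k≤ = begin
            k ≤⟨ ∑-mono X (λ u → ≤-trans (ind-¬all (λ v → ¬? (adj? v u)) D) (≤-reflexive (∑-cong D λ v → ind-¬¬ (adj? v u)))) ⟩
            ∑ X (λ u → ∑ D λ v → ind (adj? v u)) ≡⟨ ∑-swap X D _ ⟩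
            ∑ D (λ v → ∑ X λ u → ind (adj? v u)) ≡⟨ ∑-cong D (λ v → ∑-filter M? V _) ⟩
            ∑ D (λ v → ∑ V λ u → ind (M? u) *ℕ ind (adj? v u)) ≤⟨ ∑-mono D degree ⟩
            ∑ D (λ _ → n) ≡⟨ ∑-const D n ⟩
            length D *ℕ n ≡⟨ *-comm (length D) n ⟩
            n *ℕ length D ∎

        -- The weight of `Ω` is chosen to equal the loss b ^ (- |D|) in `extensions`. The two
        -- cancel, and the sums over `D` and `T` join to a sum over all S.
        Ω-ok : 2 ^ length X *ℕ Ω b W ok ≤ b ^ length W *ℕ ∑ (sublists V) near
        Ω-ok = begin
          2 ^ length X *ℕ Ω b W ok ≡⟨ Ω-* b W (2 ^ length X) ok ⟨
          Ω b W (λ D → 2 ^ length X *ℕ ok D) ≤⟨ Ω-mono b W extensions ⟩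
          Ω b W (λ D → b ^ length D *ℕ ∑ (sublists X) (G D)) ≡⟨ Ω-pow b W _ ⟩
          b ^ length W *ℕ ∑ (sublists W) (λ D → ∑ (sublists X) (G D)) ≡⟨ cong (b ^ length W *ℕ_) (∑-sublists-split M? V G) ⟨
          b ^ length W *ℕ ∑ (sublists V) (λ S → G (filter (¬? ∘ M?) S) (filter M? S)) ≤⟨ *-monoʳ-≤ (b ^ length W) (∑-mono (sublists V) G≤near) ⟩
          b ^ length W *ℕ ∑ (sublists V) near ∎
          where open ≤-Reasoning

        ok-or-bad : ∀ D → 1 ≤ ok D + (tail D + edges D)
        ok-or-bad D = go (indep? D) (length D ≤? t)
          (≤-trans (ind-¬ (indep? D)) (+-monoʳ-≤ (ind (indep? D)) (≤-trans
            (ind-¬all (λ u → All.all? (λ v → ¬? (adj? u v)) D) D)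
            (∑-mono D λ u → ≤-trans (ind-¬all (λ v → ¬? (adj? u v)) D) (≤-reflexive (∑-cong D λ v → ind-¬¬ (adj? u v)))))))
          where
          go : (p : Dec (Indep D)) (q : Dec (length D ≤ t)) → 1 ≤ ind p + edges D → 1 ≤ ind p *ℕ ind q + (ind (¬? q) + edges D)
          go (yes _) (yes _) _ = s≤s z≤n
          go (no _)  (yes _) e = e
          go p       (no _)  _ = m≤n⇒m≤o+n (ind p *ℕ 0) (s≤s z≤n)

        total : suc b ^ length W ≤ Ω b W ok + (Ω b W tail + Ω b W edges)
        total = begin
          suc b ^ length W ≡⟨ Ω-1 b W ⟨
          Ω b W (λ _ → 1) ≤⟨ Ω-mono b W ok-or-bad ⟩
          Ω b W (λ D → ok D + (tail D + edges D)) ≡⟨ Ω-+ b W ok _ ⟩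
          Ω b W ok + Ω b W (λ D → tail D + edges D) ≡⟨ cong (Ω b W ok +_) (Ω-+ b W tail edges) ⟩
          Ω b W ok + (Ω b W tail + Ω b W edges) ∎
          where open ≤-Reasoning

        instance
          b≢0 : NonZero b
          b≢0 = m^n≢0 2 n

        -- A crude estimate suffices: each large `D` weighs at most b ^ (- t) relative to the empty
        -- set, and there are at most 2 ^ |W| of them.
        Ω-tail : b ^ t *ℕ Ω b W tail ≤ b ^ length W *ℕ 2 ^ length W
        Ω-tail = begin
          b ^ t *ℕ Ω b W tail ≡⟨ Ω-* b W (b ^ t) tail ⟨
          Ω b W (λ D → b ^ t *ℕ tail D) ≤⟨ Ω-mono b W (λ D → large D (length D ≤? t)) ⟩
          Ω b W (λ D → b ^ length D *ℕ 1) ≡⟨ Ω-pow b W (λ _ → 1) ⟩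
          b ^ length W *ℕ ∑ (sublists W) (λ _ → 1) ≡⟨ cong (b ^ length W *ℕ_) (length-sublists W) ⟩
          b ^ length W *ℕ 2 ^ length W ∎
          where
          open ≤-Reasoning
          large : ∀ D (q : Dec (length D ≤ t)) → b ^ t *ℕ ind (¬? q) ≤ b ^ length D *ℕ 1
          large D (yes _) = ≤-trans (≤-reflexive (*-zeroʳ (b ^ t))) z≤n
          large D (no ≰t) = *-monoˡ-≤ 1 (^-monoʳ-≤ b (≰⇒≥ ≰t))

        Ω-edges : suc b *ℕ suc b *ℕ Ω b W edges ≤ length W *ℕ d *ℕ suc b ^ length W
        Ω-edges = begin
          suc b *ℕ suc b *ℕ Ω b W edges ≡⟨ Ω-∑∑ b (λ u v → ind (adj? u v)) (λ u → ind-false (adj? u u) (adj-irrefl u)) W ⟩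
          ∑ W (λ u → ∑ W λ v → ind (adj? u v)) *ℕ g ≤⟨ *-monoˡ-≤ g (∑-mono W λ u → ≤-trans
             (≤-reflexive (∑-filter (¬? ∘ M?) V _)) (codegree u)) ⟩
          ∑ W (λ _ → d) *ℕ g ≡⟨ cong (_*ℕ g) (∑-const W d) ⟩
          length W *ℕ d *ℕ g ∎
          where
          open ≤-Reasoning
          g = suc b ^ length W

        -- The hypotheses make the large `D` and the `D` with an edge each at most a fraction 1/c of
        -- the total weight (b + 1) ^ |W|; these are the two copies in the last summand.
        near-lower-bound : ∀ c → c *ℕ 2 ^ length W ≤ b ^ t → c *ℕ (length W *ℕ d) ≤ suc b *ℕ suc b →
          c *ℕ (2 ^ length X *ℕ suc b ^ length W) ≤
          c *ℕ (b ^ length W *ℕ ∑ (sublists V) near) + 2 *ℕ (2 ^ length X *ℕ suc b ^ length W)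
        near-lower-bound c few-large few-edges = begin
          c *ℕ (H *ℕ g) ≤⟨ *-monoʳ-≤ c (*-monoʳ-≤ H total) ⟩
          c *ℕ (H *ℕ (Ω b W ok + (Ω b W tail + Ω b W edges))) ≡⟨ lem₁ c H (Ω b W ok) (Ω b W tail) (Ω b W edges) ⟩
          c *ℕ (H *ℕ Ω b W ok) + H *ℕ (c *ℕ Ω b W tail + c *ℕ Ω b W edges)
            ≤⟨ +-mono-≤ (*-monoʳ-≤ c Ω-ok) (*-monoʳ-≤ H (+-mono-≤ tail≤ edges≤)) ⟩
          c *ℕ (b ^ length W *ℕ ∑ (sublists V) near) + H *ℕ (g + g) ≡⟨ cong (c *ℕ (b ^ length W *ℕ ∑ (sublists V) near) +_) (lem₂ H g) ⟩
          _ ∎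
          where
          open ≤-Reasoning
          H = 2 ^ length X
          g = suc b ^ length W
          lem₁ : ∀ c h x y z → c *ℕ (h *ℕ (x + (y + z))) ≡ c *ℕ (h *ℕ x) + h *ℕ (c *ℕ y + c *ℕ z)
          lem₁ = solve-∀
          lem₂ : ∀ h g → h *ℕ (g + g) ≡ 2 *ℕ (h *ℕ g)
          lem₂ = solve-∀
          lem₃ : ∀ a c x → a *ℕ (c *ℕ x) ≡ c *ℕ (a *ℕ x)
          lem₃ = solve-∀
          tail≤ : c *ℕ Ω b W tail ≤ g
          tail≤ = ≤-trans (*-cancelˡ-≤ (b ^ t) {{m^n≢0 b t}} (begin
            b ^ t *ℕ (c *ℕ Ω b W tail) ≡⟨ lem₃ (b ^ t) c _ ⟩
            c *ℕ (b ^ t *ℕ Ω b W tail) ≤⟨ *-monoʳ-≤ c Ω-tail ⟩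
            c *ℕ (b ^ length W *ℕ 2 ^ length W) ≡⟨ lem₃ c (b ^ length W) (2 ^ length W) ⟩
            b ^ length W *ℕ (c *ℕ 2 ^ length W) ≤⟨ *-monoʳ-≤ (b ^ length W) few-large ⟩
            b ^ length W *ℕ b ^ t ≡⟨ *-comm (b ^ length W) (b ^ t) ⟩
            b ^ t *ℕ b ^ length W ∎)) (^-monoˡ-≤ (length W) (n≤1+n b))
          edges≤ : c *ℕ Ω b W edges ≤ g
          edges≤ = *-cancelˡ-≤ (suc b *ℕ suc b) (begin
            suc b *ℕ suc b *ℕ (c *ℕ Ω b W edges) ≡⟨ lem₃ (suc b *ℕ suc b) c _ ⟩
            c *ℕ (suc b *ℕ suc b *ℕ Ω b W edges) ≤⟨ *-monoʳ-≤ c Ω-edges ⟩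
            c *ℕ (length W *ℕ d *ℕ g) ≡⟨ *-assoc c (length W *ℕ d) g ⟨
            c *ℕ (length W *ℕ d) *ℕ g ≤⟨ *-monoˡ-≤ g few-edges ⟩
            suc b *ℕ suc b *ℕ g ∎)

    module Family {I : Set} (M : I → A → Set) (M? : ∀ i u → Dec (M i u)) (t : ℕ) where

      near : I → List A → ℕ
      near i = NearClass.near (M i) (M? i) t

      near≤1 : ∀ S i → near i S ≤ 1
      near≤1 S i = ind-*-elim (indep? S) (NearClass.defects (M i) (M? i) t S ≤? t) λ _ _ → ≤-refl

      near-bonferroni : ∀ (F : List I) S → ∑ F (λ i → near i S) ≤ ind (indep? S) + pairs F (λ i j → near i S *ℕ near j S)
      near-bonferroni F S = go (indep? S)
        where
        go : Dec (Indep S) → ∑ F (λ i → near i S) ≤ ind (indep? S) + pairs F (λ i j → near i S *ℕ near j S)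
        go (yes p) = subst (λ z → ∑ F (λ i → near i S) ≤ z + pairs F (λ i j → near i S *ℕ near j S))
            (sym (ind-true (indep? S) p)) (bonferroni F (λ i → near i S) (near≤1 S))
        go (no ¬p) = ≤-trans (≤-reflexive (trans (∑-cong F λ i → cong (_*ℕ _) (ind-false (indep? S) ¬p))
          (trans (∑-const F 0) (*-zeroʳ (length F))))) z≤n

      defects-∩ : ∀ i j S → ∑ S (λ v → ind (¬? (M? i v ×-dec M? j v))) ≤
        ∑ S (λ v → ind (¬? (M? i v))) + ∑ S (λ v → ind (¬? (M? j v)))
      defects-∩ i j S = ≤-trans (∑-mono S λ v → pt (M? i v) (M? j v)) (≤-reflexive (∑-+ S _ _))
        where
        pt : ∀ {P Q : Set} (p : Dec P) (q : Dec Q) → ind (¬? (p ×-dec q)) ≤ ind (¬? p) + ind (¬? q)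
        pt (yes _) (yes _) = z≤n
        pt (yes _) (no _)  = ≤-refl
        pt (no _)  q       = s≤s z≤n

      near-both : ∀ i j S → near i S *ℕ near j S ≤ ind (∑ S (λ v → ind (¬? (M? i v ×-dec M? j v))) ≤? t + t)
      near-both i j S = go (indep? S) (_ ≤? t) (_ ≤? t)
        where
        go : (p : Dec (Indep S)) (q : Dec (∑ S (λ v → ind (¬? (M? i v))) ≤ t)) (r : Dec (∑ S (λ v → ind (¬? (M? j v))) ≤ t)) →
          ind p *ℕ ind q *ℕ (ind p *ℕ ind r) ≤ ind (∑ S (λ v → ind (¬? (M? i v ×-dec M? j v))) ≤? t + t)
        go (no _)  _       _       = z≤n
        go (yes _) (no _)  _       = z≤n
        go (yes _) (yes _) (no _)  = z≤n
        go (yes _) (yes q) (yes r) = ≤-reflexive (sym (ind-true (_ ≤? t + t) (≤-trans (defects-∩ i j S) (+-mono-≤ q r))))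

      near-pair : ∀ i j → 16 ^ length V *ℕ ∑ (sublists V) (λ S → near i S *ℕ near j S) ≤
        16 ^ (t + t) *ℕ (17 ^ length V *ℕ 2 ^ ∑ V (λ v → ind (M? i v ×-dec M? j v)))
      near-pair i j = begin
        _ ≤⟨ *-monoʳ-≤ (16 ^ length V) (∑-mono (sublists V) (near-both i j)) ⟩
        _ ≤⟨ ∑-sublists-few (λ v → ¬? (M? i v ×-dec M? j v)) V (t + t) ⟩
        _ ≡⟨ cong (λ z → 16 ^ (t + t) *ℕ (17 ^ length V *ℕ 2 ^ z)) (∑-cong V λ v → ind-¬¬ (M? i v ×-dec M? j v)) ⟩
        _ ∎
        where open ≤-Reasoning

      ∑-near≤ : ∀ (F : List I) c → AllPairs (λ i j → ∑ (sublists V) (λ S → near i S *ℕ near j S) ≤ c) F →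
        ∑ F (λ i → ∑ (sublists V) (near i)) ≤ length (filter indep? (sublists V)) + length F *ℕ (length F *ℕ c)
      ∑-near≤ F c h = begin
        ∑ F (λ i → ∑ (sublists V) (near i)) ≡⟨ ∑-swap F (sublists V) near ⟩
        ∑ (sublists V) (λ S → ∑ F (λ i → near i S)) ≤⟨ ∑-mono (sublists V) (near-bonferroni F) ⟩
        _ ≡⟨ ∑-+ (sublists V) (λ S → ind (indep? S)) _ ⟩
        _ ≡⟨ cong₂ _+_ (sym (length-filter-∑ indep? (sublists V))) (pairs-∑ F (sublists V) (λ S i j → near i S *ℕ near j S)) ⟩
        _ ≤⟨ +-monoʳ-≤ _ (pairs-bound h) ⟩
        _ ∎
        where open ≤-Reasoning

  -- The estimate for large dimension

  ∑-ind+¬ : {A : Set} {P : A → Set} (P? : ∀ x → Dec (P x)) (xs : List A) →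
    ∑ xs (λ x → ind (P? x)) + ∑ xs (λ x → ind (¬? (P? x))) ≡ length xs
  ∑-ind+¬ P? xs = trans (sym (∑-+ xs _ _)) (trans (∑-cong xs λ x → pt (P? x)) (trans (∑-const xs 1) (*-identityʳ _)))
    where
    pt : ∀ {P : Set} (p : Dec P) → ind p + ind (¬? p) ≡ 1
    pt (yes _) = refl
    pt (no _)  = refl

  ^-distribʳ-* : ∀ k m n → (m *ℕ n) ^ k ≡ m ^ k *ℕ n ^ k
  ^-distribʳ-* zero    m n = refl
  ^-distribʳ-* (suc k) m n = trans (cong (m *ℕ n *ℕ_) (^-distribʳ-* k m n)) ([m*n]*[o*p]≡[m*o]*[n*p] m n (m ^ k) (n ^ k))

  module Torus (m t : ℕ) where

    n b : ℕ
    n = suc m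
    b = 2 ^ n

    V : List (Vertex 3 n)
    V = vertices 3 n

    open IndependentSets (Adjacent 3 n) (adjacent? 3 n) (λ {u} {v} → adjacent-sym n {u} {v}) (adjacent-irrefl n) V
    open Family InClass inClass? t

    -- The complement of a class is the union of the two other colour classes, and `colour-degree`
    -- applies to each.
    codegree : ∀ p u → ∑ V (λ v → ind (¬? (inClass? p v)) *ℕ ind (adjacent? 3 n u v)) ≤ n + n
    codegree p@(a , c) u = begin
      _ ≤⟨ ∑-mono V (λ v → ≤-trans (*-monoˡ-≤ (adj v) (two (colour (true Vec.∷ a) c v)))
            (≤-reflexive (lem (col v (suc zero)) (col v (suc (suc zero))) (adj v)))) ⟩
      ∑ V (λ v → adj v *ℕ col v (suc zero) + adj v *ℕ col v (suc (suc zero))) ≡⟨ ∑-+ V _ _ ⟩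
      _ ≤⟨ +-mono-≤ (colour-degree (true Vec.∷ a) c (suc zero) u) (colour-degree (true Vec.∷ a) c (suc (suc zero)) u) ⟩
      n + n ∎
      where
      open ≤-Reasoning
      adj : Vertex 3 n → ℕ
      adj v = ind (adjacent? 3 n u v)
      col : Vertex 3 n → Fin 3 → ℕ
      col v x = ind (colour (true Vec.∷ a) c v ≟ᶠ x)
      two : ∀ x → ind (¬? (x ≟ᶠ zero)) ≤ ind (x ≟ᶠ suc zero) + ind (x ≟ᶠ suc (suc zero))
      two zero             = z≤n
      two (suc zero)       = ≤-refl
      two (suc (suc zero)) = ≤-refl
      lem : ∀ x y a → (x + y) *ℕ a ≡ a *ℕ x + a *ℕ y
      lem = solve-∀

    degree : ∀ p u → ∑ V (λ v → ind (inClass? p v) *ℕ ind (adjacent? 3 n u v)) ≤ n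
    degree (a , c) u = ≤-trans (≤-reflexive (∑-cong V λ v → *-comm (ind (colour (true Vec.∷ a) c v ≟ᶠ zero)) _))
      (colour-degree (true Vec.∷ a) c zero u)

    class-indep : ∀ p {u v} → InClass p u → InClass p v → ¬ Adjacent 3 n u v
    class-indep (a , c) {u} {v} eu ev adj = colour-proper (true Vec.∷ a) c {u} {v} adj (trans eu (sym ev))

    class-size : ∀ p → length (filter (inClass? p) V) ≡ 3 ^ m
    class-size p@(a , c) = trans (length-filter-∑ (inClass? p) V) (colour-class-size true a c zero)

    coclass-size : ∀ p → length (filter (¬? ∘ inClass? p) V) ≡ 2 *ℕ 3 ^ m
    coclass-size p@(a , c) = trans (length-filter-∑ (¬? ∘ inClass? p) V) (+-cancelˡ-≡ (3 ^ m) (∑ V λ v → ind (¬? (inClass? p v))) (2 *ℕ 3 ^ m)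
      (trans (cong (_+ (∑ V λ v → ind (¬? (inClass? p v)))) (sym (colour-class-size true a c zero)))
        (trans (∑-ind+¬ (inClass? p) V) (length-vertices n))))

    K : ℕ
    K = 3 *ℕ 2 ^ m

    -- The coefficient 3 of the error collects three losses of 1/c each: large defect sets, defect
    -- sets with an edge, and sets near two classes.
    many-near : ∀ c x → c *ℕ 2 ^ (2 *ℕ 3 ^ m) ≤ b ^ t → c *ℕ (2 *ℕ 3 ^ m *ℕ (n + n)) ≤ suc b *ℕ suc b →
      (∀ {p p′} → p ≢ p′ → ∑ (sublists V) (λ S → near p S *ℕ near p′ S) ≤ x) →
      c *ℕ (K *ℕ x) ≤ 2 ^ 3 ^ m →
      c *ℕ (K *ℕ (2 ^ 3 ^ m *ℕ suc b ^ (2 *ℕ 3 ^ m))) ≤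
      c *ℕ (b ^ (2 *ℕ 3 ^ m) *ℕ numIndependentSets 3 n) + 3 *ℕ (K *ℕ (2 ^ 3 ^ m *ℕ suc b ^ (2 *ℕ 3 ^ m)))
    many-near c x few-large few-edges overlaps few-pairs = begin
      c *ℕ (K *ℕ (H *ℕ g)) ≡⟨ lem₁ c K (H *ℕ g) ⟩
      K *ℕ (c *ℕ (H *ℕ g)) ≡⟨ cong (_*ℕ (c *ℕ (H *ℕ g))) (length-classes m) ⟨
      length F *ℕ (c *ℕ (H *ℕ g)) ≡⟨ ∑-const F _ ⟨
      ∑ F (λ _ → c *ℕ (H *ℕ g)) ≤⟨ ∑-mono F each ⟩
      ∑ F (λ p → c *ℕ (w *ℕ ∑ (sublists V) (near p)) + 2 *ℕ (H *ℕ g)) ≡⟨ ∑-+ F _ _ ⟩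
      ∑ F (λ p → c *ℕ (w *ℕ ∑ (sublists V) (near p))) + ∑ F (λ _ → 2 *ℕ (H *ℕ g))
        ≡⟨ cong₂ _+_ (trans (∑-* F c _) (cong (c *ℕ_) (∑-* F w _))) (trans (∑-const F _) (cong (_*ℕ (2 *ℕ (H *ℕ g))) (length-classes m))) ⟩
      c *ℕ (w *ℕ ∑ F (λ p → ∑ (sublists V) (near p))) + K *ℕ (2 *ℕ (H *ℕ g))
        ≤⟨ +-monoˡ-≤ _ (*-monoʳ-≤ c (*-monoʳ-≤ w (∑-near≤ F x (AllPairs.map overlaps (classes-unique m))))) ⟩
      c *ℕ (w *ℕ (σ + length F *ℕ (length F *ℕ x))) + K *ℕ (2 *ℕ (H *ℕ g))
        ≡⟨ cong (λ z → c *ℕ (w *ℕ (σ + z *ℕ (z *ℕ x))) + K *ℕ (2 *ℕ (H *ℕ g))) (length-classes m) ⟩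
      c *ℕ (w *ℕ (σ + K *ℕ (K *ℕ x))) + K *ℕ (2 *ℕ (H *ℕ g)) ≡⟨ lem₂ c w σ K x H g ⟩
      c *ℕ (w *ℕ σ) + (K *ℕ (c *ℕ (K *ℕ x) *ℕ w) + 2 *ℕ (K *ℕ (H *ℕ g)))
        -- The pair term is so small that its factor b ^ N may grow to (b + 1) ^ N, which gives it
        -- the form of the main term.
        ≤⟨ +-monoʳ-≤ (c *ℕ (w *ℕ σ)) (+-monoˡ-≤ _ (*-monoʳ-≤ K (*-mono-≤ few-pairs (^-monoˡ-≤ (2 *ℕ 3 ^ m) (n≤1+n b))))) ⟩
      c *ℕ (w *ℕ σ) + (K *ℕ (H *ℕ g) + 2 *ℕ (K *ℕ (H *ℕ g))) ∎
      where
      open ≤-Reasoning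
      F = classes m
      H = 2 ^ 3 ^ m
      g = suc b ^ (2 *ℕ 3 ^ m)
      w = b ^ (2 *ℕ 3 ^ m)
      σ = numIndependentSets 3 n
      lem₁ : ∀ c k y → c *ℕ (k *ℕ y) ≡ k *ℕ (c *ℕ y)
      lem₁ = solve-∀
      lem₂ : ∀ c w a k x h g → c *ℕ (w *ℕ (a + k *ℕ (k *ℕ x))) + k *ℕ (2 *ℕ (h *ℕ g)) ≡
        c *ℕ (w *ℕ a) + (k *ℕ (c *ℕ (k *ℕ x) *ℕ w) + 2 *ℕ (k *ℕ (h *ℕ g)))
      lem₂ = solve-∀
      each : ∀ p → c *ℕ (H *ℕ g) ≤ c *ℕ (w *ℕ ∑ (sublists V) (near p)) + 2 *ℕ (H *ℕ g)
      each p = subst₂ (λ s r → c *ℕ (2 ^ s *ℕ suc b ^ r) ≤ c *ℕ (b ^ r *ℕ ∑ (sublists V) (near p)) + 2 *ℕ (2 ^ s *ℕ suc b ^ r))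
        (class-size p) (coclass-size p)
        (NearClass.LowerBound.near-lower-bound (InClass p) (inClass? p) t (λ {u} {v} → class-indep p {u} {v}) n (n + n) (degree p) (codegree p) c
          (subst (λ r → c *ℕ 2 ^ r ≤ b ^ t) (sym (coclass-size p)) few-large)
          (subst (λ r → c *ℕ (r *ℕ (n + n)) ≤ suc b *ℕ suc b) (sym (coclass-size p)) few-edges))

    -- The budget of 2t stray elements costs 16 ^ (2t) = 2 ^ (8t), the free choice within the
    -- overlap 2 ^ r. The Markov loss (17/16) ^ |V| is another 2 ^ r, because |V| = 9r and (17/16)^9
    -- < 2.
    overlap-bound : ∀ r → 3 ^ m ≡ 3 *ℕ r → ∀ {p p′} → p ≢ p′ →
      ∑ (sublists V) (λ S → near p S *ℕ near p′ S) ≤ 2 ^ (8 *ℕ t + 2 *ℕ r)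
    overlap-bound r eq {p} {p′} ne = *-cancelˡ-≤ (16 ^ length V) {{m^n≢0 16 (length V)}} (begin
      16 ^ length V *ℕ ∑ (sublists V) (λ S → near p S *ℕ near p′ S) ≤⟨ near-pair p p′ ⟩
      16 ^ (t + t) *ℕ (17 ^ length V *ℕ 2 ^ o) ≤⟨ *-monoʳ-≤ (16 ^ (t + t)) (*-mono-≤ seventeen (^-monoʳ-≤ 2 o≤r)) ⟩
      16 ^ (t + t) *ℕ (2 ^ r *ℕ 16 ^ length V *ℕ 2 ^ r) ≡⟨ lem (16 ^ (t + t)) (2 ^ r) (16 ^ length V) ⟩
      16 ^ length V *ℕ (16 ^ (t + t) *ℕ (2 ^ r *ℕ 2 ^ r)) ≡⟨ cong (16 ^ length V *ℕ_) powers ⟩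
      16 ^ length V *ℕ 2 ^ (8 *ℕ t + 2 *ℕ r) ∎)
      where
      open ≤-Reasoning
      o = ∑ V (λ v → ind (inClass? p v ×-dec inClass? p′ v))
      o≤r : o ≤ r
      o≤r = *-cancelˡ-≤ 3 (≤-trans (class-overlap p p′ ne) (≤-reflexive eq))
      |V| : length V ≡ 9 *ℕ r
      |V| = trans (length-vertices n) (trans (cong (3 *ℕ_) eq) (sym (*-assoc 3 3 r)))
      seventeen : 17 ^ length V ≤ 2 ^ r *ℕ 16 ^ length V
      seventeen = begin
        17 ^ length V ≡⟨ cong (17 ^_) |V| ⟩
        17 ^ (9 *ℕ r) ≡⟨ ^-*-assoc 17 9 r ⟨
        (17 ^ 9) ^ r ≤⟨ ^-monoˡ-≤ r (from-yes (17 ^ 9 ≤? 2 *ℕ 16 ^ 9)) ⟩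
        (2 *ℕ 16 ^ 9) ^ r ≡⟨ ^-distribʳ-* r 2 (16 ^ 9) ⟩
        2 ^ r *ℕ (16 ^ 9) ^ r ≡⟨ cong (2 ^ r *ℕ_) (trans (^-*-assoc 16 9 r) (cong (16 ^_) (sym |V|))) ⟩
        2 ^ r *ℕ 16 ^ length V ∎
      lem : ∀ a c v → a *ℕ (c *ℕ v *ℕ c) ≡ v *ℕ (a *ℕ (c *ℕ c))
      lem = solve-∀
      exps : ∀ t r → 4 *ℕ (t + t) + (r + r) ≡ 8 *ℕ t + 2 *ℕ r
      exps = solve-∀
      powers : 16 ^ (t + t) *ℕ (2 ^ r *ℕ 2 ^ r) ≡ 2 ^ (8 *ℕ t + 2 *ℕ r)
      powers = trans (cong₂ _*ℕ_ (^-*-assoc 2 4 (t + t)) (sym (^-distribˡ-+-* 2 r r)))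
        (trans (sym (^-distribˡ-+-* 2 (4 *ℕ (t + t)) (r + r))) (cong (2 ^_) (exps t r)))

  n<2^n : ∀ n → n < 2 ^ n
  n<2^n zero    = s≤s z≤n
  n<2^n (suc n) = ≤-trans (+-mono-≤ (m^n>0 2 n) (n<2^n n)) (≤-reflexive (cong (2 ^ n +_) (sym (+-identityʳ _))))

  n<3^n : ∀ n → n < 3 ^ n
  n<3^n n = <-≤-trans (n<2^n n) (^-monoˡ-≤ n (n≤1+n 2))

  -- From 7 on, 3 (n + 1)² ≤ 4 n² holds, so one step multiplies the left side by at most 4. It fails
  -- at 6, hence the start at 7 and the constant 49 = 7².
  square-exp : ∀ j → (7 + j) *ℕ (7 + j) *ℕ 3 ^ j ≤ 49 *ℕ 4 ^ j
  square-exp zero    = ≤-refl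
  square-exp (suc j) = begin
    (8 + j) *ℕ (8 + j) *ℕ (3 *ℕ 3 ^ j) ≤⟨ m≤m+n _ ((4 + 8 *ℕ j + j *ℕ j) *ℕ 3 ^ j) ⟩
    (8 + j) *ℕ (8 + j) *ℕ (3 *ℕ 3 ^ j) + (4 + 8 *ℕ j + j *ℕ j) *ℕ 3 ^ j ≡⟨ lem j (3 ^ j) ⟩
    4 *ℕ ((7 + j) *ℕ (7 + j) *ℕ 3 ^ j) ≤⟨ *-monoʳ-≤ 4 (square-exp j) ⟩
    4 *ℕ (49 *ℕ 4 ^ j) ≡⟨ lem′ (4 ^ j) ⟩
    49 *ℕ (4 *ℕ 4 ^ j) ∎
    where
    open ≤-Reasoning
    lem : ∀ j e → (8 + j) *ℕ (8 + j) *ℕ (3 *ℕ e) + (4 + 8 *ℕ j + j *ℕ j) *ℕ e ≡ 4 *ℕ ((7 + j) *ℕ (7 + j) *ℕ e)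
    lem = solve-∀
    lem′ : ∀ e → 4 *ℕ (49 *ℕ e) ≡ 49 *ℕ (4 *ℕ e)
    lem′ = solve-∀

  -- The quadratic bound n² · 3^n ≤ 49 · 4^n with one factor n spent on 4 · 49 · q.
  linear-exp : ∀ q n → 7 ≤ n → 196 *ℕ q ≤ n → 4 *ℕ q *ℕ n *ℕ 3 ^ n ≤ 4 ^ n
  linear-exp q n 7≤n q≤n = *-cancelˡ-≤ 49 (begin
    49 *ℕ (4 *ℕ q *ℕ n *ℕ 3 ^ n) ≡⟨ lem q n (3 ^ n) ⟩
    196 *ℕ q *ℕ (n *ℕ 3 ^ n) ≤⟨ *-monoˡ-≤ (n *ℕ 3 ^ n) q≤n ⟩
    n *ℕ (n *ℕ 3 ^ n) ≡⟨ *-assoc n n (3 ^ n) ⟨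
    n *ℕ n *ℕ 3 ^ n ≤⟨ subst (λ n → n *ℕ n *ℕ 3 ^ n ≤ 49 *ℕ 4 ^ n) (m+[n∸m]≡n 7≤n) (shifted (n ∸ 7)) ⟩
    49 *ℕ 4 ^ n ∎)
    where
    open ≤-Reasoning
    lem : ∀ q n e → 49 *ℕ (4 *ℕ q *ℕ n *ℕ e) ≡ 196 *ℕ q *ℕ (n *ℕ e)
    lem = solve-∀
    lem′ : ∀ a x e → a *ℕ (x *ℕ e) ≡ a *ℕ e *ℕ x
    lem′ = solve-∀
    shifted : ∀ j → (7 + j) *ℕ (7 + j) *ℕ 3 ^ (7 + j) ≤ 49 *ℕ 4 ^ (7 + j)
    shifted j = begin
      (7 + j) *ℕ (7 + j) *ℕ 3 ^ (7 + j) ≡⟨ cong ((7 + j) *ℕ (7 + j) *ℕ_) (^-distribˡ-+-* 3 7 j) ⟩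
      (7 + j) *ℕ (7 + j) *ℕ (3 ^ 7 *ℕ 3 ^ j) ≡⟨ lem′ ((7 + j) *ℕ (7 + j)) (3 ^ 7) (3 ^ j) ⟩
      (7 + j) *ℕ (7 + j) *ℕ 3 ^ j *ℕ 3 ^ 7 ≤⟨ *-mono-≤ (square-exp j) (^-monoˡ-≤ 7 (n≤1+n 3)) ⟩
      49 *ℕ 4 ^ j *ℕ 4 ^ 7 ≡⟨ lem′ 49 (4 ^ 7) (4 ^ j) ⟨
      49 *ℕ (4 ^ 7 *ℕ 4 ^ j) ≡⟨ cong (49 *ℕ_) (^-distribˡ-+-* 4 7 j) ⟨
      49 *ℕ 4 ^ (7 + j) ∎

  module Asymptotic (q k : ℕ) (q≤k : 3 *ℕ q ≤ k) (158≤k : 158 ≤ k) (196q≤n : 196 *ℕ q ≤ 5 + k) where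

    -- 3 ^ m = 81 t, so the 81 t elements of a class dwarf t defects, while n > 162 makes t defects too costly.
    m n t b N K : ℕ
    m = 4 + k
    n = suc m
    t = 3 ^ k
    b = 2 ^ n
    N = 2 *ℕ 3 ^ m
    K = 3 *ℕ 2 ^ m

    c≤2^t : 3 *ℕ q ≤ 2 ^ t
    c≤2^t = ≤-trans q≤k (≤-trans (<⇒≤ (n<3^n k)) (<⇒≤ (n<2^n t)))

    7≤n : 7 ≤ n
    7≤n = ≤-trans (from-yes (7 ≤? 163)) (+-monoʳ-≤ 5 158≤k)

    4^n : b *ℕ b ≡ 4 ^ n
    4^n = sym (^-distribʳ-* n 2 2)

    few-large : 3 *ℕ q *ℕ 2 ^ N ≤ b ^ t
    few-large = begin
      3 *ℕ q *ℕ 2 ^ N ≤⟨ *-monoˡ-≤ (2 ^ N) c≤2^t ⟩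
      2 ^ t *ℕ 2 ^ N ≡⟨ ^-distribˡ-+-* 2 t N ⟨
      -- N is 162 t and the constant 3q costs one more t; this is where n ≥ 163, that is k ≥ 158,
      -- comes from.
      2 ^ (t + N) ≡⟨ cong (2 ^_) (lem t) ⟩
      2 ^ (163 *ℕ t) ≤⟨ ^-monoʳ-≤ 2 (*-monoˡ-≤ t (+-monoʳ-≤ 5 158≤k)) ⟩
      2 ^ (n *ℕ t) ≡⟨ ^-*-assoc 2 n t ⟨
      b ^ t ∎
      where
      open ≤-Reasoning
      lem : ∀ t → t + 2 *ℕ (3 *ℕ (3 *ℕ (3 *ℕ (3 *ℕ t)))) ≡ 163 *ℕ t
      lem = solve-∀

    -- The expected number of ordered adjacent pairs in a random `D` is at most 2nN / (b + 1)²,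
    -- which is of order n (3/4)^n.
    few-edges : 3 *ℕ q *ℕ (N *ℕ (n + n)) ≤ suc b *ℕ suc b
    few-edges = begin
      3 *ℕ q *ℕ (2 *ℕ 3 ^ m *ℕ (n + n)) ≡⟨ lem q (3 ^ m) n ⟩
      4 *ℕ q *ℕ n *ℕ (3 *ℕ 3 ^ m) ≤⟨ linear-exp q n 7≤n 196q≤n ⟩
      4 ^ n ≡⟨ 4^n ⟨
      b *ℕ b ≤⟨ *-mono-≤ (n≤1+n b) (n≤1+n b) ⟩
      suc b *ℕ suc b ∎
      where
      open ≤-Reasoning
      lem : ∀ q e n → 3 *ℕ q *ℕ (2 *ℕ e *ℕ (n + n)) ≡ 4 *ℕ q *ℕ n *ℕ (3 *ℕ e)
      lem = solve-∀

    few-pairs : 3 *ℕ q *ℕ (K *ℕ 2 ^ (8 *ℕ t + 2 *ℕ (27 *ℕ t))) ≤ 2 ^ 3 ^ m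
    few-pairs = begin
      3 *ℕ q *ℕ (K *ℕ 2 ^ e) ≤⟨ *-mono-≤ c≤2^t (*-monoˡ-≤ (2 ^ e) (*-monoˡ-≤ (2 ^ m) (n≤1+n 3))) ⟩
      2 ^ t *ℕ (2 ^ 2 *ℕ 2 ^ m *ℕ 2 ^ e) ≡⟨ cong (λ z → 2 ^ t *ℕ (z *ℕ 2 ^ e)) (^-distribˡ-+-* 2 2 m) ⟨
      2 ^ t *ℕ (2 ^ (2 + m) *ℕ 2 ^ e) ≡⟨ cong (2 ^ t *ℕ_) (^-distribˡ-+-* 2 (2 + m) e) ⟨
      2 ^ t *ℕ 2 ^ (2 + m + e) ≡⟨ ^-distribˡ-+-* 2 t (2 + m + e) ⟨
      -- In units of t the exponents are 1 for 3q, 6 for `K` and 62 for `e`; 12 of the available 81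
      -- are left over.
      2 ^ (t + (2 + m + e)) ≤⟨ ^-monoʳ-≤ 2 (≤-trans (+-monoʳ-≤ t (+-monoˡ-≤ e 2+m≤)) (m≤m+n (t + (6 *ℕ t + e)) (12 *ℕ t))) ⟩
      2 ^ (t + (6 *ℕ t + e) + 12 *ℕ t) ≡⟨ cong (2 ^_) (lem t) ⟩
      2 ^ 3 ^ m ∎
      where
      open ≤-Reasoning
      e = 8 *ℕ t + 2 *ℕ (27 *ℕ t)
      lem : ∀ t → t + (6 *ℕ t + (8 *ℕ t + 2 *ℕ (27 *ℕ t))) + 12 *ℕ t ≡ 3 *ℕ (3 *ℕ (3 *ℕ (3 *ℕ t)))
      lem = solve-∀
      lem′ : ∀ k → 6 + k + 5 *ℕ k ≡ 6 *ℕ suc k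
      lem′ = solve-∀
      2+m≤ : 6 + k ≤ 6 *ℕ t
      2+m≤ = begin
        6 + k ≤⟨ m≤m+n (6 + k) (5 *ℕ k) ⟩
        6 + k + 5 *ℕ k ≡⟨ lem′ k ⟩
        6 *ℕ suc k ≤⟨ *-monoʳ-≤ 6 (n<3^n k) ⟩
        6 *ℕ t ∎

    small-rate : q *ℕ N ≤ b *ℕ b
    small-rate = begin
      q *ℕ (2 *ℕ 3 ^ m) ≤⟨ m≤m+n _ (10 *ℕ q *ℕ 3 ^ m + 12 *ℕ q *ℕ m *ℕ 3 ^ m) ⟩
      q *ℕ (2 *ℕ 3 ^ m) + (10 *ℕ q *ℕ 3 ^ m + 12 *ℕ q *ℕ m *ℕ 3 ^ m) ≡⟨ lem q m (3 ^ m) ⟩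
      4 *ℕ q *ℕ n *ℕ 3 ^ n ≤⟨ linear-exp q n 7≤n 196q≤n ⟩
      4 ^ n ≡⟨ 4^n ⟨
      b *ℕ b ∎
      where
      open ≤-Reasoning
      lem : ∀ q m e → q *ℕ (2 *ℕ e) + (10 *ℕ q *ℕ e + 12 *ℕ q *ℕ m *ℕ e) ≡ 4 *ℕ q *ℕ (1 + m) *ℕ (3 *ℕ e)
      lem = solve-∀

    binomial-lower-bound : q *ℕ (K *ℕ 2 ^ 3 ^ m *ℕ suc b ^ N) ≤
      q *ℕ (b ^ N *ℕ numIndependentSets 3 n) + K *ℕ 2 ^ 3 ^ m *ℕ suc b ^ N
    binomial-lower-bound = *-cancelˡ-≤ 3 (begin
      3 *ℕ (q *ℕ (K *ℕ 2 ^ 3 ^ m *ℕ suc b ^ N)) ≡⟨ lem₁ q K (2 ^ 3 ^ m) (suc b ^ N) ⟩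
      3 *ℕ q *ℕ (K *ℕ (2 ^ 3 ^ m *ℕ suc b ^ N)) ≤⟨ Torus.many-near m t (3 *ℕ q) (2 ^ (8 *ℕ t + 2 *ℕ (27 *ℕ t)))
        few-large few-edges (Torus.overlap-bound m t (27 *ℕ t) (lem₃ t)) few-pairs ⟩
      3 *ℕ q *ℕ (b ^ N *ℕ numIndependentSets 3 n) + 3 *ℕ (K *ℕ (2 ^ 3 ^ m *ℕ suc b ^ N))
        ≡⟨ lem₂ q (b ^ N *ℕ numIndependentSets 3 n) K (2 ^ 3 ^ m) (suc b ^ N) ⟩
      3 *ℕ (q *ℕ (b ^ N *ℕ numIndependentSets 3 n) + K *ℕ 2 ^ 3 ^ m *ℕ suc b ^ N) ∎)
      where
      open ≤-Reasoning
      lem₁ : ∀ q k h g → 3 *ℕ (q *ℕ (k *ℕ h *ℕ g)) ≡ 3 *ℕ q *ℕ (k *ℕ (h *ℕ g))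
      lem₁ = solve-∀
      lem₂ : ∀ q a k h g → 3 *ℕ q *ℕ a + 3 *ℕ (k *ℕ (h *ℕ g)) ≡ 3 *ℕ (q *ℕ a + k *ℕ h *ℕ g)
      lem₂ = solve-∀
      lem₃ : ∀ t → 3 *ℕ (3 *ℕ (3 *ℕ (3 *ℕ t))) ≡ 3 *ℕ (27 *ℕ t)
      lem₃ = solve-∀

  -- Bernoulli's inequality (1 - 1/(x + 1)) ^ N ≥ 1 - N/(x + 1), multiplied by (x + 1) ^ (N + 1).
  bernoulli : ∀ x N → suc x *ℕ suc x ^ N ≤ suc x *ℕ x ^ N + N *ℕ suc x ^ N
  bernoulli x zero    = m≤m+n _ _
  bernoulli x (suc N) = begin
    y *ℕ (y *ℕ y ^ N) ≤⟨ *-monoʳ-≤ y (bernoulli x N) ⟩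
    y *ℕ (y *ℕ x ^ N + N *ℕ y ^ N) ≡⟨ lem₁ x (x ^ N) N (y ^ N) ⟩
    y *ℕ (x *ℕ x ^ N) + N *ℕ (y *ℕ y ^ N) + y *ℕ x ^ N ≤⟨ +-monoʳ-≤ (y *ℕ (x *ℕ x ^ N) + N *ℕ (y *ℕ y ^ N)) (*-monoʳ-≤ y (^-monoˡ-≤ N (n≤1+n x))) ⟩
    y *ℕ (x *ℕ x ^ N) + N *ℕ (y *ℕ y ^ N) + y *ℕ y ^ N ≡⟨ lem₂ (y *ℕ (x *ℕ x ^ N)) N (y *ℕ y ^ N) ⟩
    _ ∎
    where
    open ≤-Reasoning
    y = suc x
    lem₁ : ∀ x e n f → (1 + x) *ℕ ((1 + x) *ℕ e + n *ℕ f) ≡ (1 + x) *ℕ (x *ℕ e) + n *ℕ ((1 + x) *ℕ f) + (1 + x) *ℕ e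
    lem₁ = solve-∀
    lem₂ : ∀ a n f → a + n *ℕ f + f ≡ a + (1 + n) *ℕ f
    lem₂ = solve-∀

  -- (1 + 1/b)(1 − 1/b) = 1 − 1/b² with b = p + 1, cleared of denominators.
  conjugate-power : ∀ q p N → suc q *ℕ N ≤ suc p *ℕ suc p →
    q *ℕ (suc p ^ N *ℕ suc p ^ N) ≤ suc q *ℕ (p ^ N *ℕ suc (suc p) ^ N)
  conjugate-power q p N small = subst₂ (λ y x → q *ℕ y ≤ suc q *ℕ x)
    (trans (cong (_^ N) (lem p)) (^-distribʳ-* N (suc p) (suc p))) (^-distribʳ-* N p (suc (suc p)))
    (+-cancelˡ-≤ (suc x ^ N) _ _ (*-cancelˡ-≤ (suc x) (begin
      suc x *ℕ (suc q *ℕ suc x ^ N) ≡⟨ lem₁ (suc x) (suc q) (suc x ^ N) ⟩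
      suc q *ℕ (suc x *ℕ suc x ^ N) ≤⟨ *-monoʳ-≤ (suc q) (bernoulli x N) ⟩
      suc q *ℕ (suc x *ℕ x ^ N + N *ℕ suc x ^ N) ≡⟨ lem₂ (suc q) (suc x) (x ^ N) N (suc x ^ N) ⟩
      suc q *ℕ N *ℕ suc x ^ N + suc x *ℕ (suc q *ℕ x ^ N) ≤⟨ +-monoˡ-≤ _ (*-monoˡ-≤ (suc x ^ N) (≤-trans small (≤-reflexive (sym (lem p))))) ⟩
      suc x *ℕ suc x ^ N + suc x *ℕ (suc q *ℕ x ^ N) ≡⟨ *-distribˡ-+ (suc x) (suc x ^ N) _ ⟨
      suc x *ℕ (suc x ^ N + suc q *ℕ x ^ N) ∎)))
    where
    open ≤-Reasoning
    x = p *ℕ suc (suc p)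
    lem : ∀ p → 1 + p *ℕ (2 + p) ≡ (1 + p) *ℕ (1 + p)
    lem = solve-∀
    lem₁ : ∀ x q y → x *ℕ (q *ℕ y) ≡ q *ℕ (x *ℕ y)
    lem₁ = solve-∀
    lem₂ : ∀ q y e n f → q *ℕ (y *ℕ e + n *ℕ f) ≡ q *ℕ n *ℕ f + y *ℕ (q *ℕ e)
    lem₂ = solve-∀

  -- `conjugate-power` trades (1 + 1/b) ^ N for (1 - 1/b) ^ (- N). The factor q/(q + 1) is paid
  -- twice, once for this exchange and once in the given lower bound for `A`.
  combine : ∀ q p N F A → suc q *ℕ N ≤ suc p *ℕ suc p →
    suc q *ℕ (F *ℕ suc (suc p) ^ N) ≤ suc q *ℕ (suc p ^ N *ℕ A) + F *ℕ suc (suc p) ^ N →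
    q *ℕ q *ℕ F *ℕ suc p ^ N ≤ suc q *ℕ suc q *ℕ A *ℕ p ^ N
  combine q p N F A small lower = *-cancelˡ-≤ B {{m^n≢0 (suc p) N}} (begin
    B *ℕ (q *ℕ q *ℕ F *ℕ B) ≡⟨ lem₁ q F B ⟩
    q *ℕ F *ℕ (q *ℕ (B *ℕ B)) ≤⟨ *-monoʳ-≤ (q *ℕ F) (conjugate-power q p N small) ⟩
    q *ℕ F *ℕ (suc q *ℕ (P *ℕ G)) ≡⟨ lem₂ q F (suc q) P G ⟩
    suc q *ℕ P *ℕ (q *ℕ (F *ℕ G)) ≤⟨ *-monoʳ-≤ (suc q *ℕ P) (+-cancelˡ-≤ (F *ℕ G) _ _ (≤-trans lower (≤-reflexive (+-comm _ (F *ℕ G))))) ⟩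
    suc q *ℕ P *ℕ (suc q *ℕ (B *ℕ A)) ≡⟨ lem₃ (suc q) P B A ⟩
    B *ℕ (suc q *ℕ suc q *ℕ A *ℕ P) ∎)
    where
    open ≤-Reasoning
    B = suc p ^ N
    P = p ^ N
    G = suc (suc p) ^ N
    lem₁ : ∀ q f b → b *ℕ (q *ℕ q *ℕ f *ℕ b) ≡ q *ℕ f *ℕ (q *ℕ (b *ℕ b))
    lem₁ = solve-∀
    lem₂ : ∀ q f r p g → q *ℕ f *ℕ (r *ℕ (p *ℕ g)) ≡ r *ℕ p *ℕ (q *ℕ (f *ℕ g))
    lem₂ = solve-∀
    lem₃ : ∀ r p b a → r *ℕ p *ℕ (r *ℕ (b *ℕ a)) ≡ b *ℕ (r *ℕ r *ℕ a *ℕ p)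
    lem₃ = solve-∀

open import Data.Nat using (ℕ; _∸_; _^_; _≤_) renaming (_*_ to _*ℕ_)
open import Data.Integer using (+_)
open import Data.Rational using (ℚ; 0ℚ; 1ℚ; _/_; _-_; _*_; _<_) renaming (_≤_ to _≤ℚ_)
open import Data.Product using (∃-syntax)
open import Data.Integer using (-[1+_]; +≤+; +<+)
import Data.Integer as ℤ
import Data.Integer.Properties as ℤ
open import Data.Nat using (zero; suc; pred; z≤n) renaming (_+_ to _+ℕ_)
import Data.Nat.Properties as ℕ
open import Data.Nat.Tactic.RingSolver using (solve-∀)
open import Data.Product using (_,_)
open import Data.Rational using (mkℚ; _+_; -_; toℚᵘ; *<*; Positive; nonNegative)
import Data.Rational.Properties as ℚ
open import Data.Rational.Solver using (module +-*-Solver)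
open import Data.Rational.Unnormalised using (mkℚᵘ; *≡*; *≤*; _≃_)
import Data.Rational.Unnormalised.Properties as ℚᵘ
open import Relation.Binary.PropositionalEquality
open import Relation.Nullary.Decidable using (from-yes)
open Counting using (module Asymptotic; combine)

-- Partial sums of the exponential series

toℚᵘ-ℕtoℚ : ∀ k → toℚᵘ (ℕtoℚ k) ≃ mkℚᵘ (+ k) 0
toℚᵘ-ℕtoℚ k = ℚ.toℚᵘ-fromℚᵘ (mkℚᵘ (+ k) 0)

ℕtoℚ-* : ∀ a b → ℕtoℚ (a *ℕ b) ≡ ℕtoℚ a * ℕtoℚ b
ℕtoℚ-* a b = ℚ.toℚᵘ-injective (ℚᵘ.≃-trans (toℚᵘ-ℕtoℚ (a *ℕ b)) (ℚᵘ.≃-trans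
  (*≡* (cong (ℤ._* + 1) (ℤ.pos-* a b)))
  (ℚᵘ.≃-sym (ℚᵘ.≃-trans (ℚ.toℚᵘ-homo-* (ℕtoℚ a) (ℕtoℚ b)) (ℚᵘ.*-cong (toℚᵘ-ℕtoℚ a) (toℚᵘ-ℕtoℚ b))))))

ℕtoℚ-suc : ∀ a → ℕtoℚ (suc a) ≡ 1ℚ + ℕtoℚ a
ℕtoℚ-suc a = ℚ.toℚᵘ-injective (ℚᵘ.≃-trans (toℚᵘ-ℕtoℚ (suc a)) (ℚᵘ.≃-trans
  (*≡* (cong (λ z → (+ 1 ℤ.+ z) ℤ.* + 1) (sym (ℤ.*-identityʳ (+ a)))))
  (ℚᵘ.≃-sym (ℚᵘ.≃-trans (ℚ.toℚᵘ-homo-+ 1ℚ (ℕtoℚ a)) (ℚᵘ.+-cong (toℚᵘ-ℕtoℚ 1) (toℚᵘ-ℕtoℚ a))))))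

ℕtoℚ-mono : ∀ {a b} → a ≤ b → ℕtoℚ a ≤ℚ ℕtoℚ b
ℕtoℚ-mono {a} {b} a≤b = ℚ.toℚᵘ-cancel-≤ (ℚᵘ.≤-respˡ-≃ (ℚᵘ.≃-sym (toℚᵘ-ℕtoℚ a))
  (ℚᵘ.≤-respʳ-≃ (ℚᵘ.≃-sym (toℚᵘ-ℕtoℚ b)) (*≤* (ℤ.*-monoʳ-≤-nonNeg (+ 1) (+≤+ a≤b)))))

ℕtoℚ-nonNeg : ∀ a → 0ℚ ≤ℚ ℕtoℚ a
ℕtoℚ-nonNeg a = ℕtoℚ-mono {0} {a} z≤n

reciprocal-* : ∀ k → (+ 1 / suc k) * ℕtoℚ (suc k) ≡ 1ℚ
reciprocal-* k = ℚ.toℚᵘ-injective (ℚᵘ.≃-trans (ℚ.toℚᵘ-homo-* (+ 1 / suc k) (ℕtoℚ (suc k)))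
  (ℚᵘ.≃-trans (ℚᵘ.*-cong (ℚ.toℚᵘ-fromℚᵘ (mkℚᵘ (+ 1) k)) (toℚᵘ-ℕtoℚ (suc k)))
    (*≡* (trans (ℤ.*-identityʳ _) (trans (ℤ.*-identityˡ _) (trans (cong (λ z → + suc z) (sym (ℕ.*-identityʳ k))) (sym (ℤ.*-identityˡ _))))))))

mul-mono : ∀ {r p q} → 0ℚ ≤ℚ r → p ≤ℚ q → r * p ≤ℚ r * q
mul-mono {r} 0≤r = ℚ.*-monoˡ-≤-nonNeg r {{nonNegative 0≤r}}

mul-nonNeg : ∀ {p q} → 0ℚ ≤ℚ p → 0ℚ ≤ℚ q → 0ℚ ≤ℚ p * q
mul-nonNeg {p} 0≤p 0≤q = ℚ.≤-trans (ℚ.≤-reflexive (sym (ℚ.*-zeroʳ p))) (mul-mono 0≤p 0≤q)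

add-nonNeg : ∀ {p q} → 0ℚ ≤ℚ p → 0ℚ ≤ℚ q → 0ℚ ≤ℚ p + q
add-nonNeg = ℚ.+-mono-≤

reciprocal-nonNeg : ∀ k → 0ℚ ≤ℚ + 1 / suc k
reciprocal-nonNeg k = ℚ.nonNegative⁻¹ (+ 1 / suc k) {{ℚ.normalize-nonNeg 1 (suc k)}}

0≤1 : 0ℚ ≤ℚ 1ℚ
0≤1 = ℕtoℚ-nonNeg 1

expTerm-nonNeg : ∀ x → 0ℚ ≤ℚ x → ∀ k → 0ℚ ≤ℚ expTerm x k
expTerm-nonNeg x 0≤x zero    = 0≤1
expTerm-nonNeg x 0≤x (suc k) = mul-nonNeg (mul-nonNeg (expTerm-nonNeg x 0≤x k) 0≤x) (reciprocal-nonNeg k)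

expPartial-nonNeg : ∀ x → 0ℚ ≤ℚ x → ∀ K → 0ℚ ≤ℚ expPartial x K
expPartial-nonNeg x 0≤x zero    = 0≤1
expPartial-nonNeg x 0≤x (suc K) = add-nonNeg (expPartial-nonNeg x 0≤x K) (expTerm-nonNeg x 0≤x (suc K))

expTerm-suc : ∀ x k → x * expTerm x k ≡ ℕtoℚ (suc k) * expTerm x (suc k)
expTerm-suc x k = begin
  x * T ≡⟨ ℚ.*-identityʳ (x * T) ⟨
  x * T * 1ℚ ≡⟨ cong (x * T *_) (reciprocal-* k) ⟨
  x * T * (r * ℕtoℚ (suc k)) ≡⟨ solve 4 (λ x T r c → x :* T :* (r :* c) := c :* (T :* x :* r)) refl x T r (ℕtoℚ (suc k)) ⟩
  ℕtoℚ (suc k) * (T * x * r) ∎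
  where
  open ≡-Reasoning
  open +-*-Solver
  T = expTerm x k
  r = + 1 / suc k

expTerm-0 : ∀ k → expTerm 0ℚ (suc k) ≡ 0ℚ
expTerm-0 k = trans (cong (_* (+ 1 / suc k)) (ℚ.*-zeroʳ (expTerm 0ℚ k))) (ℚ.*-zeroˡ (+ 1 / suc k))

expPartial-0 : ∀ K → expPartial 0ℚ K ≡ 1ℚ
expPartial-0 zero    = refl
expPartial-0 (suc K) = trans (cong₂ _+_ (expPartial-0 K) (expTerm-0 K)) (ℚ.+-identityʳ 1ℚ)

module _ (x y : ℚ) (0≤x : 0ℚ ≤ℚ x) (0≤y : 0ℚ ≤ℚ y) where

  private
    0≤x+y : 0ℚ ≤ℚ x + y
    0≤x+y = add-nonNeg 0≤x 0≤y

  -- The mean value estimate (x + y) ^ (k + 1) - x ^ (k + 1) ≤ (k + 1) y (x + y) ^ k, divided by (k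
  -- + 1)!.
  expTerm-+ : ∀ k → expTerm (x + y) (suc k) ≤ℚ expTerm x (suc k) + y * expTerm (x + y) k
  expTerm-+ zero = ℚ.≤-reflexive (solve 2 (λ x y → con 1ℚ :* (x :+ y) :* con 1ℚ := con 1ℚ :* x :* con 1ℚ :+ y :* con 1ℚ) refl x y)
    where open +-*-Solver
  expTerm-+ (suc k) = begin
    S * a * r ≡⟨ solve 4 (λ S x y r → S :* (x :+ y) :* r := r :* x :* S :+ r :* y :* S) refl S x y r ⟩
    r * x * S + r * y * S ≤⟨ ℚ.+-monoˡ-≤ (r * y * S) (mul-mono (mul-nonNeg 0≤r 0≤x) (expTerm-+ k)) ⟩
    r * x * (S₀ + y * T) + r * y * S
      ≡⟨ solve 6 (λ r x y S S₀ T → r :* x :* (S₀ :+ y :* T) :+ r :* y :* S := (S₀ :* x :* r :+ r :* y :* S) :+ r :* y :* (x :* T)) refl r x y S S₀ T ⟩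
    (S₀ * x * r + r * y * S) + r * y * (x * T)
      -- Enlarging x T to a T makes it (k + 1) S; with the copy of S already present this gives k +
      -- 2 copies, which cancel `r`.
      ≤⟨ ℚ.+-monoʳ-≤ (S₀ * x * r + r * y * S) (mul-mono (mul-nonNeg 0≤r 0≤y) xT≤aT) ⟩
    (S₀ * x * r + r * y * S) + r * y * (a * T) ≡⟨ cong (λ z → (S₀ * x * r + r * y * S) + r * y * z) (expTerm-suc a k) ⟩
    (S₀ * x * r + r * y * S) + r * y * (ℕtoℚ (suc k) * S)
      ≡⟨ solve 6 (λ r x y S S₀ c → (S₀ :* x :* r :+ r :* y :* S) :+ r :* y :* (c :* S) := S₀ :* x :* r :+ y :* S :* (r :* (con 1ℚ :+ c)))
          refl r x y S S₀ (ℕtoℚ (suc k)) ⟩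
    S₀ * x * r + y * S * (r * (1ℚ + ℕtoℚ (suc k)))
      ≡⟨ cong (λ z → S₀ * x * r + y * S * z) (trans (cong (r *_) (sym (ℕtoℚ-suc (suc k)))) (reciprocal-* (suc k))) ⟩
    S₀ * x * r + y * S * 1ℚ ≡⟨ cong (λ z → S₀ * x * r + z) (ℚ.*-identityʳ (y * S)) ⟩
    S₀ * x * r + y * S ∎
    where
    open ℚ.≤-Reasoning
    open +-*-Solver
    a = x + y
    r = + 1 / suc (suc k)
    S = expTerm a (suc k)
    S₀ = expTerm x (suc k)
    T = expTerm a k
    0≤r = reciprocal-nonNeg (suc k)
    xT≤aT : x * T ≤ℚ a * T
    xT≤aT = begin
      x * T ≡⟨ ℚ.+-identityʳ (x * T) ⟨
      x * T + 0ℚ ≤⟨ ℚ.+-monoʳ-≤ (x * T) (mul-nonNeg 0≤y (expTerm-nonNeg a 0≤x+y k)) ⟩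
      x * T + y * T ≡⟨ ℚ.*-distribʳ-+ T x y ⟨
      a * T ∎

  expPartial-suc-+ : ∀ K → expPartial (x + y) (suc K) ≤ℚ expPartial x (suc K) + y * expPartial (x + y) K
  expPartial-suc-+ zero = ℚ.≤-trans (ℚ.+-monoʳ-≤ 1ℚ (expTerm-+ 0)) (ℚ.≤-reflexive (sym (ℚ.+-assoc 1ℚ (expTerm x 1) (y * 1ℚ))))
  expPartial-suc-+ (suc K) = ℚ.≤-trans (ℚ.+-mono-≤ (expPartial-suc-+ K) (expTerm-+ (suc K)))
    (ℚ.≤-reflexive (solve 5 (λ e y f t s → (e :+ y :* f) :+ (t :+ y :* s) := (e :+ t) :+ y :* (f :+ s)) refl
      (expPartial x (suc K)) y (expPartial (x + y) K) (expTerm x (suc (suc K))) (expTerm (x + y) (suc K))))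
    where open +-*-Solver

  -- The truncated form of (1 - y) exp(x + y) ≤ exp x, one step of the induction towards (1 - y) ^ N
  -- exp(N y) ≤ 1.
  expPartial-+ : ∀ K → expPartial (x + y) K ≤ℚ expPartial x K + y * expPartial (x + y) K
  expPartial-+ zero = ℚ.≤-trans (ℚ.≤-reflexive (sym (ℚ.+-identityʳ 1ℚ))) (ℚ.+-monoʳ-≤ 1ℚ (mul-nonNeg 0≤y 0≤1))
  expPartial-+ (suc K) = ℚ.≤-trans (expPartial-suc-+ K) (ℚ.+-monoʳ-≤ (expPartial x (suc K)) (mul-mono 0≤y
    (ℚ.≤-trans (ℚ.≤-reflexive (sym (ℚ.+-identityʳ _))) (ℚ.+-monoʳ-≤ (expPartial (x + y) K) (expTerm-nonNeg (x + y) 0≤x+y (suc K))))))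

-- E(N/b) (1 − 1/b)^N ≤ 1 for a partial sum E of the exponential series and b = p + 1.
expPartial-power : ∀ p K N → expPartial (ℕtoℚ N * (+ 1 / suc p)) K * ℕtoℚ (p ^ N) ≤ℚ ℕtoℚ (suc p ^ N)
expPartial-power p K zero = ℚ.≤-reflexive (trans (cong (λ z → expPartial z K * 1ℚ) (ℚ.*-zeroˡ (+ 1 / suc p)))
  (trans (ℚ.*-identityʳ _) (expPartial-0 K)))
expPartial-power p K (suc N) = begin
  expPartial (ℕtoℚ (suc N) * y) K * ℕtoℚ (p *ℕ p ^ N) ≡⟨ cong₂ (λ z w → expPartial z K * w) eq (ℕtoℚ-* p (p ^ N)) ⟩
  E′ * (ℕtoℚ p * P) ≡⟨ solve 3 (λ e p q → e :* (p :* q) := q :* (p :* e)) refl E′ (ℕtoℚ p) P ⟩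
  P * (ℕtoℚ p * E′) ≤⟨ mul-mono (ℕtoℚ-nonNeg (p ^ N)) step ⟩
  P * (ℕtoℚ (suc p) * E) ≡⟨ solve 3 (λ e p q → q :* (p :* e) := p :* (e :* q)) refl E (ℕtoℚ (suc p)) P ⟩
  ℕtoℚ (suc p) * (E * P) ≤⟨ mul-mono (ℕtoℚ-nonNeg (suc p)) (expPartial-power p K N) ⟩
  ℕtoℚ (suc p) * ℕtoℚ (suc p ^ N) ≡⟨ ℕtoℚ-* (suc p) (suc p ^ N) ⟨
  ℕtoℚ (suc p *ℕ suc p ^ N) ∎
  where
  open ℚ.≤-Reasoning
  open +-*-Solver
  y = + 1 / suc p
  x = ℕtoℚ N * y
  E = expPartial x K
  E′ = expPartial (x + y) K
  P = ℕtoℚ (p ^ N)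
  eq : ℕtoℚ (suc N) * y ≡ x + y
  eq = trans (cong (_* y) (ℕtoℚ-suc N)) (solve 2 (λ n y → (con 1ℚ :+ n) :* y := n :* y :+ y) refl (ℕtoℚ N) y)
  -- This is `expPartial-+` multiplied by b = p + 1, since b (1 - 1/b) = p.
  step : ℕtoℚ p * E′ ≤ℚ ℕtoℚ (suc p) * E
  step = begin
    ℕtoℚ p * E′ ≡⟨ solve 2 (λ p e → p :* e := (con 1ℚ :+ p) :* e :- e) refl (ℕtoℚ p) E′ ⟩
    (1ℚ + ℕtoℚ p) * E′ - E′ ≡⟨ cong (λ z → z * E′ - E′) (ℕtoℚ-suc p) ⟨
    ℕtoℚ (suc p) * E′ - E′ ≤⟨ ℚ.+-monoˡ-≤ (- E′) (mul-mono (ℕtoℚ-nonNeg (suc p))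
       (expPartial-+ x y (mul-nonNeg (ℕtoℚ-nonNeg N) (reciprocal-nonNeg p)) (reciprocal-nonNeg p) K)) ⟩
    ℕtoℚ (suc p) * (E + y * E′) - E′ ≡⟨ solve 4 (λ b e y f → b :* (e :+ y :* f) :- f := b :* e :+ (y :* b) :* f :- f) refl (ℕtoℚ (suc p)) E y E′ ⟩
    ℕtoℚ (suc p) * E + y * ℕtoℚ (suc p) * E′ - E′ ≡⟨ cong (λ z → ℕtoℚ (suc p) * E + z * E′ - E′) (reciprocal-* p) ⟩
    ℕtoℚ (suc p) * E + 1ℚ * E′ - E′ ≡⟨ solve 2 (λ a f → a :+ con 1ℚ :* f :- f := a) refl (ℕtoℚ (suc p) * E) E′ ⟩
    ℕtoℚ (suc p) * E ∎

-- Passage from natural numbers to the rational statement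

powℚ-3/2 : ∀ m → powℚ (+ 3 / 2) m * ℕtoℚ (2 ^ suc m) ≡ ℕtoℚ (2 *ℕ 3 ^ m)
powℚ-3/2 zero    = refl
powℚ-3/2 (suc m) = begin
  (+ 3 / 2) * P * ℕtoℚ (2 *ℕ 2 ^ suc m) ≡⟨ cong ((+ 3 / 2) * P *_) (ℕtoℚ-* 2 (2 ^ suc m)) ⟩
  (+ 3 / 2) * P * (ℕtoℚ 2 * ℕtoℚ (2 ^ suc m)) ≡⟨ solve 4 (λ a p c b → a :* p :* (c :* b) := a :* c :* (p :* b))
      refl (+ 3 / 2) P (ℕtoℚ 2) (ℕtoℚ (2 ^ suc m)) ⟩
  ℕtoℚ 3 * (P * ℕtoℚ (2 ^ suc m)) ≡⟨ cong (ℕtoℚ 3 *_) (powℚ-3/2 m) ⟩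
  ℕtoℚ 3 * ℕtoℚ (2 *ℕ 3 ^ m) ≡⟨ ℕtoℚ-* 3 (2 *ℕ 3 ^ m) ⟨
  ℕtoℚ (3 *ℕ (2 *ℕ 3 ^ m)) ≡⟨ cong ℕtoℚ (lem (3 ^ m)) ⟩
  ℕtoℚ (2 *ℕ (3 *ℕ 3 ^ m)) ∎
  where
  open ≡-Reasoning
  open +-*-Solver
  P = powℚ (+ 3 / 2) m
  lem : ∀ e → 3 *ℕ (2 *ℕ e) ≡ 2 *ℕ (3 *ℕ e)
  lem = solve-∀

-- The witness is read off the representation: a positive fraction has numerator at least 1, so its
-- own denominator serves.
unit-fraction-below : ∀ ε → 0ℚ < ε → ∃[ d ] 1ℚ ≤ℚ ε * ℕtoℚ (suc d)
unit-fraction-below ε@(mkℚ (+ suc k) d c) _ = d , ℚ.toℚᵘ-cancel-≤ (ℚᵘ.≤-respʳ-≃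
  (ℚᵘ.≃-sym (ℚᵘ.≃-trans (ℚ.toℚᵘ-homo-* ε (ℕtoℚ (suc d))) (ℚᵘ.*-congˡ (toℚᵘ-ℕtoℚ (suc d)))))
  (*≤* (+≤+ (ℕ.≤-trans (ℕ.≤-reflexive (lem d)) (ℕ.≤-trans (ℕ.m≤m+n (suc d) (k *ℕ suc d)) (ℕ.≤-reflexive (sym (ℕ.*-identityʳ (suc k *ℕ suc d)))))))))
  where
  lem : ∀ d → 1 *ℕ (suc d *ℕ 1) ≡ suc d
  lem = solve-∀
unit-fraction-below (mkℚ (+ zero) d c) (*<* (+<+ ()))
unit-fraction-below (mkℚ -[1+ k ] d c) (*<* ())

-- With Q = 2 (d + 1), the two factors 1 - 1/Q from `combine` lose together at most 2/Q = 1/(d + 1)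
-- ≤ ε.
square-loss : ∀ ε d → 1ℚ ≤ℚ ε * ℕtoℚ (suc d) →
  (1ℚ - ε) * ℕtoℚ (suc (suc (d +ℕ d)) *ℕ suc (suc (d +ℕ d))) ≤ℚ ℕtoℚ (suc (d +ℕ d) *ℕ suc (d +ℕ d))
square-loss ε d h = begin
  (1ℚ - ε) * ℕtoℚ (suc (suc (d +ℕ d)) *ℕ suc (suc (d +ℕ d))) ≡⟨ cong ((1ℚ - ε) *_) (ℕtoℚ-* (suc (suc (d +ℕ d))) (suc (suc (d +ℕ d)))) ⟩
  (1ℚ - ε) * (Q * Q) ≡⟨ solve 2 (λ e Q → (con 1ℚ :- e) :* (Q :* Q) := Q :* Q :+ :- (Q :* (e :* Q))) refl ε Q ⟩
  Q * Q + - (Q * (ε * Q)) ≡⟨ cong (λ z → Q * Q + - (Q * (ε * z))) Q≡2D ⟩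
  Q * Q + - (Q * (ε * (ℕtoℚ 2 * D))) ≡⟨ solve 4 (λ e Q c D → Q :* Q :+ :- (Q :* (e :* (c :* D))) := Q :* Q :+ :- (Q :* c :* (e :* D)))
      refl ε Q (ℕtoℚ 2) D ⟩
  Q * Q + - (Q * ℕtoℚ 2 * (ε * D)) ≤⟨ ℚ.+-monoʳ-≤ (Q * Q) (ℚ.neg-antimono-≤
      (mul-mono (mul-nonNeg (ℕtoℚ-nonNeg (suc (suc (d +ℕ d)))) (ℕtoℚ-nonNeg 2)) h)) ⟩
  Q * Q + - (Q * ℕtoℚ 2 * 1ℚ) ≡⟨ cong (λ z → z * z + - (z * ℕtoℚ 2 * 1ℚ)) (ℕtoℚ-suc (suc (d +ℕ d))) ⟩
  (1ℚ + q) * (1ℚ + q) + - ((1ℚ + q) * ℕtoℚ 2 * 1ℚ)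
    ≡⟨ solve 1 (λ q → (con 1ℚ :+ q) :* (con 1ℚ :+ q) :+ :- ((con 1ℚ :+ q) :* con (ℕtoℚ 2) :* con 1ℚ) := q :* q :+ :- con 1ℚ) refl q ⟩
  q * q + - 1ℚ ≤⟨ ℚ.+-monoʳ-≤ (q * q) (ℚ.neg-antimono-≤ 0≤1) ⟩
  q * q + - 0ℚ ≡⟨ ℚ.+-identityʳ (q * q) ⟩
  q * q ≡⟨ ℕtoℚ-* (suc (d +ℕ d)) (suc (d +ℕ d)) ⟨
  ℕtoℚ (suc (d +ℕ d) *ℕ suc (d +ℕ d)) ∎
  where
  open ℚ.≤-Reasoning
  open +-*-Solver
  Q = ℕtoℚ (suc (suc (d +ℕ d)))
  q = ℕtoℚ (suc (d +ℕ d))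
  D = ℕtoℚ (suc d)
  lem : ∀ d → 2 +ℕ (d +ℕ d) ≡ 2 *ℕ (1 +ℕ d)
  lem = solve-∀
  Q≡2D : Q ≡ ℕtoℚ 2 * D
  Q≡2D = trans (cong ℕtoℚ (lem d)) (ℕtoℚ-* 2 (suc d))

-- As 1 - ε may be negative, it enters only through the second hypothesis, multiplied by factors
-- that are known to be nonnegative.
from-naturals : ∀ ε δ q Q p N F A K → 0ℚ ≤ℚ δ → (1ℚ - ε) * ℕtoℚ (suc Q *ℕ suc Q) ≤ℚ ℕtoℚ (q *ℕ q) →
  q *ℕ q *ℕ F *ℕ suc p ^ N ≤ suc Q *ℕ suc Q *ℕ A *ℕ p ^ N →
  δ * ℕtoℚ (suc p) ≡ ℕtoℚ N →
  (1ℚ - ε) * ℕtoℚ F * expPartial δ K ≤ℚ ℕtoℚ A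
from-naturals ε δ q Q p N F A K 0≤δ loss bound rate =
  ℚ.*-cancelʳ-≤-pos (R * B) {{RB>0}} (begin
    (1ℚ - ε) * f * E * (R * B) ≡⟨ solve 5 (λ e f E R B → e :* f :* E :* (R :* B) := f :* E :* B :* (e :* R)) refl (1ℚ - ε) f E R B ⟩
    f * E * B * ((1ℚ - ε) * R) ≤⟨ mul-mono (mul-nonNeg (mul-nonNeg (ℕtoℚ-nonNeg F) (expPartial-nonNeg δ 0≤δ K)) (ℕtoℚ-nonNeg (suc p ^ N))) loss ⟩
    f * E * B * r ≡⟨ solve 4 (λ f E B r → f :* E :* B :* r := E :* (r :* f :* B)) refl f E B r ⟩
    E * (r * f * B) ≤⟨ mul-mono (expPartial-nonNeg δ 0≤δ K) bound′ ⟩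
    E * (R * a * P) ≡⟨ solve 4 (λ E R a P → E :* (R :* a :* P) := R :* a :* (E :* P)) refl E R a P ⟩
    R * a * (E * P) ≤⟨ mul-mono (mul-nonNeg (ℕtoℚ-nonNeg (suc Q *ℕ suc Q)) (ℕtoℚ-nonNeg A))
      (subst (λ z → expPartial z K * P ≤ℚ B) δ≡ (expPartial-power p K N)) ⟩
    R * a * B ≡⟨ solve 3 (λ R a B → R :* a :* B := a :* (R :* B)) refl R a B ⟩
    a * (R * B) ∎)
  where
  open ℚ.≤-Reasoning
  open +-*-Solver
  f = ℕtoℚ F
  a = ℕtoℚ A
  E = expPartial δ K
  R = ℕtoℚ (suc Q *ℕ suc Q)
  r = ℕtoℚ (q *ℕ q)
  B = ℕtoℚ (suc p ^ N)
  P = ℕtoℚ (p ^ N)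
  RB>0 : Positive (R * B)
  RB>0 = subst Positive (ℕtoℚ-* (suc Q *ℕ suc Q) (suc p ^ N))
    (ℚ.normalize-pos (suc Q *ℕ suc Q *ℕ suc p ^ N) 1 {{_}} {{ℕ.m*n≢0 (suc Q *ℕ suc Q) (suc p ^ N) {{_}} {{ℕ.m^n≢0 (suc p) N}}}})
  prod : ∀ x y z → ℕtoℚ (x *ℕ y *ℕ z) ≡ ℕtoℚ x * ℕtoℚ y * ℕtoℚ z
  prod x y z = trans (ℕtoℚ-* (x *ℕ y) z) (cong (_* ℕtoℚ z) (ℕtoℚ-* x y))
  bound′ : r * f * B ≤ℚ R * a * P
  bound′ = subst₂ _≤ℚ_ (prod (q *ℕ q) F (suc p ^ N)) (prod (suc Q *ℕ suc Q) A (p ^ N)) (ℕtoℚ-mono bound)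
  δ≡ : ℕtoℚ N * (+ 1 / suc p) ≡ δ
  δ≡ = trans (cong (_* (+ 1 / suc p)) (sym rate)) (trans (ℚ.*-assoc δ (ℕtoℚ (suc p)) (+ 1 / suc p))
    (trans (cong (δ *_) (trans (ℚ.*-comm (ℕtoℚ (suc p)) (+ 1 / suc p)) (reciprocal-* p))) (ℚ.*-identityʳ δ)))

powℚ-nonNeg : ∀ x → 0ℚ ≤ℚ x → ∀ k → 0ℚ ≤ℚ powℚ x k
powℚ-nonNeg x 0≤x zero    = 0≤1
powℚ-nonNeg x 0≤x (suc k) = mul-nonNeg 0≤x (powℚ-nonNeg x 0≤x k)

large-dimension : ∀ ε d → 1ℚ ≤ℚ ε * ℕtoℚ (suc d) → ∀ k → 163 +ℕ 196 *ℕ (2 +ℕ (d +ℕ d)) ≤ 5 +ℕ k → ∀ K →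
  (1ℚ - ε) * ℕtoℚ (3 *ℕ 2 ^ (4 +ℕ k) *ℕ 2 ^ (3 ^ (4 +ℕ k))) * expPartial (powℚ (+ 3 / 2) (4 +ℕ k)) K
    ≤ℚ ℕtoℚ (numIndependentSets 3 (5 +ℕ k))
large-dimension ε d 1≤εd k large K =
  from-naturals ε (powℚ (+ 3 / 2) m) q q p N F A K
    (powℚ-nonNeg (+ 3 / 2) (from-yes (0ℚ ℚ.≤? + 3 / 2)) m) (square-loss ε d 1≤εd)
    (combine q p N F A
      (subst (λ b → suc q *ℕ N ≤ b *ℕ b) b≡ small-rate)
      (subst (λ b → suc q *ℕ (F *ℕ suc b ^ N) ≤ suc q *ℕ (b ^ N *ℕ A) +ℕ F *ℕ suc b ^ N) b≡ binomial-lower-bound))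
    (subst (λ b → powℚ (+ 3 / 2) m * ℕtoℚ b ≡ ℕtoℚ N) b≡ (powℚ-3/2 m))
  where
  q = suc (d +ℕ d)
  k-large : 158 +ℕ 196 *ℕ suc q ≤ k
  k-large = ℕ.+-cancelˡ-≤ 5 (158 +ℕ 196 *ℕ suc q) k large
  open Asymptotic (suc q) k
    (ℕ.≤-trans (ℕ.*-monoˡ-≤ (suc q) (from-yes (3 ℕ.≤? 196))) (ℕ.≤-trans (ℕ.m≤n+m (196 *ℕ suc q) 158) k-large))
    (ℕ.≤-trans (ℕ.m≤m+n 158 (196 *ℕ suc q)) k-large)
    (ℕ.≤-trans (ℕ.m≤n+m (196 *ℕ suc q) 163) large)
    using (m; n; b; N; small-rate; binomial-lower-bound)
  p = pred b
  F = 3 *ℕ 2 ^ m *ℕ 2 ^ 3 ^ m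
  A = numIndependentSets 3 n
  b≡ : b ≡ suc p
  b≡ = sym (ℕ.suc-pred b {{ℕ.m^n≢0 2 n}})

theorem1p1 : (ε : ℚ) → 0ℚ < ε →
    ∃[ N ] ((n : ℕ) → N ≤ n → (K : ℕ) →
    (1ℚ - ε) * ℕtoℚ (3 *ℕ 2 ^ (n ∸ 1) *ℕ 2 ^ (3 ^ (n ∸ 1))) * expPartial (powℚ (+ 3 / 2) (n ∸ 1)) K
    ≤ℚ ℕtoℚ (numIndependentSets 3 n))
theorem1p1 ε 0<ε = threshold (unit-fraction-below ε 0<ε)
  where
  Bound : ℕ → Set
  Bound n = (K : ℕ) →
    (1ℚ - ε) * ℕtoℚ (3 *ℕ 2 ^ (n ∸ 1) *ℕ 2 ^ (3 ^ (n ∸ 1))) * expPartial (powℚ (+ 3 / 2) (n ∸ 1)) K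
      ≤ℚ ℕtoℚ (numIndependentSets 3 n)
  shift-by-5 : ∀ N → (∀ k → N ≤ 5 +ℕ k → Bound (5 +ℕ k)) → ∀ n → 5 ≤ n → N ≤ n → Bound n
  shift-by-5 N h n 5≤n N≤n = subst Bound (ℕ.m+[n∸m]≡n 5≤n)
    (h (n ∸ 5) (ℕ.≤-trans N≤n (ℕ.≤-reflexive (sym (ℕ.m+[n∸m]≡n 5≤n)))))
  threshold : ∃[ d ] 1ℚ ≤ℚ ε * ℕtoℚ (suc d) → ∃[ N ] ((n : ℕ) → N ≤ n → Bound n)
  threshold (d , 1≤εd) = N₀ , λ n N₀≤n → shift-by-5 N₀ (large-dimension ε d 1≤εd) n (ℕ.≤-trans (ℕ.m≤m+n 5 _) N₀≤n) N₀≤n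
    where
    -- 163 is the dimension that makes large defect sets negligible; the other summand is the
    -- threshold of `linear-exp` for q = 2 (d + 1).
    N₀ = 163 +ℕ 196 *ℕ (2 +ℕ (d +ℕ d))
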